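{- Let $G$ be a distributive graph and $\mathfrak D$ a small distributive category. Then the functor $\mathcal U(-)\circ\eta_G$ is an equivalence between the category $\mathbf{Dist}(\mathcal F(G),\mathfrak D)$ of distributive functors $\mathcal F(G)\to\mathfrak D$ and natural transformations, and the category $\mathbf{Cat}(\mathbf{Set}^{\mathfrak G})(G,\mathcal U(\mathfrak D))$ of internal functors $G\to\mathcal U(\mathfrak D)$ and internal natural transformations ($G$ being seen as a discrete internal category of $\mathbf{Set}^{\mathfrak G}$).
   Context: Distributive terms are the terms built from constants $0,1$ and a generator $x$ by binary operators $+,\times$; $T$ is the set of all of them, and $\varphi_t$ is the number of occurrences of $x$ in $t\in T$. $t[a_1,\dots,a_{\varphi_t}]$ denotes substitution of $a_i$ for the $i$-th occurrence of $x$; terms so obtained with $a_i\in A$ are the distributive expressions on $A$. The category $\mathfrak G$ has objects $\{*\}+T^2$ and, besides identities, for each $\langle t,u\rangle\in T^2$ arrows $d_1,\dots,d_{\varphi_t},c_1,\dots,c_{\varphi_u}:\langle t,u\rangle\to*$. A distributive graph is a functor $G:\mathfrak G\to\mathbf{Set}$; an arc $a\in G(\langle t,u\rangle)$ has source $t[G(d_1)(a),\dots]$ and target $u[G(c_1)(a),\dots]$. Internal categories of $\mathbf{Set}^{\mathfrak G}$ are identified with functors $\mathfrak G\to\mathbf{Cat}$ ($\mathbf{Cat}(\mathbf{Set}^{\mathfrak G})\simeq\mathbf{Cat}^{\mathfrak G}$). $\mathbf{Dist}$ is the 2-category of small distributive categories (finite sums and products with $X\times Y+X\times Z\to X\times(Y+Z)$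 invertible), distributive functors (preserving finite sums and products, up to isomorphism; no choice of structure) and natural transformations. Witnessing trees: if $X_1,\dots,X_{\varphi_t},X$ are objects of $\mathfrak D$, $t_X^{\mathfrak D}\{X_1,\dots,X_{\varphi_t}\}$ denotes the syntax tree of $t$ labelled with objects and specific sum/product diagrams (injections, projections; initial/terminal objects at leaves $0$, $1$) exhibiting $X$ as built from the $X_i$ by the operations in $t$. Given such trees for $X,(X_i)$ and $X',(X'_i)$ and arrows $f_i:X_i\to X'_i$, $t^{\mathfrak D}_{X,X'}[\![f_1,\dots,f_{\varphi_t}]\!]:X\to X'$ is the induced arrow. Distributive functors act on trees by applying the functor to all labels. The 2-functor $\mathcal U:\mathbf{Dist}\to\mathbf{Cat}(\mathbf{Set}^{\mathfrak G})$: $\mathcal U(\mathfrak D)(*)=\mathfrak D$; $\mathcal U(\mathfrak D)(\langle t,u\rangle)$ is the category whose objects are triples $\langle f:X\to Y,\ t_X^{\mathfrak D}\{X_1,\dots,X_{\varphi_t}\},\ u_Y^{\mathfrak D}\{Y_1,\dots,Y_{\varphi_u}\}\rangle$ and whose arrows to a primed triple are tuples of arrows $f_i:X_i\to X_i'$, $g_j:Y_j\to Y_j'$ of $\mathfrak D$ with $u^{\mathfrak D}_{Y,Y'}[\![g_1,\dots,g_{\varphi_u}]\!]\circ f=f'\circ t^{\mathfrak D}_{X,X'}[\![f_1,\dots,f_{\varphi_t}]\!]$; $\mathcal U(\mathfrak D)(d_i)$ and $\mathcal U(\mathfrak D)(c_j)$ send such a triple to $X_i$, $Y_j$ respectively,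 and similarly on arrows. $\mathcal U$ acts on distributive functors and natural transformations by applying them to every component. $\mathcal F(G)$: objects are the distributive expressions on $G(*)$; arrows are generated from the arcs of $G$ (from source to target), identities, injections, projections, initial maps, terminal maps, and inverse distributivity arrows by composition, copairing $(-\mid-)$ and pairing $(-,-)$, modulo the equations of distributive categories (category laws, universal equations of binary sums and products, uniqueness of arrows from $0$ and to $1$, invertibility of distributivity). It has chosen sums and products given by the term operators. The unit $\eta_G:G\to\mathcal U(\mathcal F(G))$ sends $A\in G(*)$ to $A$, and an arc $a\in G(\langle t,u\rangle)$ to the triple formed by the arrow $a:t[A_1,\dots,A_{\varphi_t}]\to u[B_1,\dots,B_{\varphi_u}]$, where $A_i=G(d_i)(a)$, $B_j=G(c_j)(a)$, and the two trees given by the chosen sums and products of $\mathcal F(G)$. -}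

module Defs where

open import Level using (Level; _⊔_; Lift; lift) renaming (suc to lsuc; zero to lzero)
open import Data.Nat.Base using (ℕ; _+_)
open import Data.Fin.Base using (Fin; zero; suc; _↑ˡ_; _↑ʳ_)
open import Data.Product.Base using (Σ; _×_; _,_; proj₁; proj₂)
open import Data.Unit.Base using (⊤; tt)
open import Relation.Binary.Core using (Rel)
open import Relation.Binary.Structures using (IsEquivalence)
open import Relation.Binary.Bundles using (Setoid)
open import Relation.Binary.PropositionalEquality.Core
  using (_≡_; refl; sym; trans; cong)
open import Relation.Binary.PropositionalEquality.Properties using (isEquivalence)
open import Axiom.UniquenessOfIdentityProofs.WithK using (uip)
import Relation.Binary.Reasoning.Setoid as SetoidReasoning

-- Objects are compared by `_≡_`, arrows by a setoid equality (needed because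
-- the arrows of the free category ℱ G form a quotient).
record Category (o h : Level) : Set (lsuc (o ⊔ h)) where
  infix  4 _≈_
  infixr 9 _∘_
  field
    Ob     : Set o
    Hom    : Ob → Ob → Set h
    _≈_    : ∀ {A B} → Rel (Hom A B) h
    id     : ∀ {A} → Hom A A
    _∘_    : ∀ {A B C} → Hom B C → Hom A B → Hom A C
    equiv  : ∀ {A B} → IsEquivalence (_≈_ {A} {B})
    assoc  : ∀ {A B C D} {f : Hom A B} {g : Hom B C} {k : Hom C D} →
             (k ∘ g) ∘ f ≈ k ∘ (g ∘ f)
    idˡ    : ∀ {A B} {f : Hom A B} → id ∘ f ≈ f
    idʳ    : ∀ {A B} {f : Hom A B} → f ∘ id ≈ f
    ∘-cong : ∀ {A B C} {f f′ : Hom B C} {g g′ : Hom A B} →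
             f ≈ f′ → g ≈ g′ → f ∘ g ≈ f′ ∘ g′

  module ≈ {A B : Ob} = IsEquivalence (equiv {A} {B})

  homSetoid : Ob → Ob → Setoid h h
  homSetoid A B = record { Carrier = Hom A B ; _≈_ = _≈_ ; isEquivalence = equiv }

  module HomReasoning {A B : Ob} = SetoidReasoning (homSetoid A B)

  id-comm : ∀ {A B} {f : Hom A B} → id ∘ f ≈ f ∘ id
  id-comm = ≈.trans idˡ (≈.sym idʳ)

  -- Equal objects give an identity arrow; used to compare arrows whose end
  -- points are only propositionally equal.
  hid : ∀ {A B} → A ≡ B → Hom A B
  hid refl = id

  hid-trans : ∀ {A B C} (p : A ≡ B) (q : B ≡ C) → hid (trans p q) ≈ hid q ∘ hid p
  hid-trans refl refl = ≈.sym idˡ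

  hid-irr : ∀ {A B} (p q : A ≡ B) → hid p ≈ hid q
  hid-irr refl refl = ≈.refl

  hid-move : ∀ {A B C D} (p : A ≡ C) (q : B ≡ D) {f : Hom A B} {g : Hom C D} →
             hid q ∘ f ≈ g ∘ hid p → hid (sym q) ∘ g ≈ f ∘ hid (sym p)
  hid-move refl refl e =
    ≈.trans idˡ (≈.trans (≈.sym idʳ) (≈.trans (≈.sym e) id-comm))

  record IsIso {A B : Ob} (f : Hom A B) : Set h where
    field
      inv  : Hom B A
      invˡ : inv ∘ f ≈ id
      invʳ : f ∘ inv ≈ id

  record Iso (A B : Ob) : Set h where
    field
      to    : Hom A B
      isIso : IsIso to

  record IsInitial (Z : Ob) : Set (o ⊔ h) where
    field
      ¡        : ∀ {A} → Hom Z A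
      ¡-unique : ∀ {A} (f : Hom Z A) → ¡ ≈ f

  record IsTerminal (Z : Ob) : Set (o ⊔ h) where
    field
      !        : ∀ {A} → Hom A Z
      !-unique : ∀ {A} (f : Hom A Z) → ! ≈ f

  record IsCoproduct {A B S : Ob} (i₁ : Hom A S) (i₂ : Hom B S) : Set (o ⊔ h) where
    field
      [_,_]   : ∀ {C} → Hom A C → Hom B C → Hom S C
      inject₁ : ∀ {C} {f : Hom A C} {g : Hom B C} → [ f , g ] ∘ i₁ ≈ f
      inject₂ : ∀ {C} {f : Hom A C} {g : Hom B C} → [ f , g ] ∘ i₂ ≈ g
      unique  : ∀ {C} {f : Hom A C} {g : Hom B C} {k : Hom S C} →
                k ∘ i₁ ≈ f → k ∘ i₂ ≈ g → [ f , g ] ≈ k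

  record IsProduct {A B P : Ob} (π₁ : Hom P A) (π₂ : Hom P B) : Set (o ⊔ h) where
    field
      ⟨_,_⟩    : ∀ {C} → Hom C A → Hom C B → Hom C P
      project₁ : ∀ {C} {f : Hom C A} {g : Hom C B} → π₁ ∘ ⟨ f , g ⟩ ≈ f
      project₂ : ∀ {C} {f : Hom C A} {g : Hom C B} → π₂ ∘ ⟨ f , g ⟩ ≈ g
      unique   : ∀ {C} {f : Hom C A} {g : Hom C B} {k : Hom C P} →
                 π₁ ∘ k ≈ f → π₂ ∘ k ≈ g → ⟨ f , g ⟩ ≈ k

record Functor {o h o′ h′} (C : Category o h) (D : Category o′ h′) :
               Set (o ⊔ h ⊔ o′ ⊔ h′) where
  private
    module C = Category C
    module D = Category D
  field
    F₀             : C.Ob → D.Ob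
    F₁             : ∀ {A B} → C.Hom A B → D.Hom (F₀ A) (F₀ B)
    identity       : ∀ {A} → F₁ (C.id {A}) D.≈ D.id
    homomorphism   : ∀ {X Y Z} {f : C.Hom X Y} {g : C.Hom Y Z} →
                     F₁ (g C.∘ f) D.≈ F₁ g D.∘ F₁ f
    F-resp-≈       : ∀ {A B} {f g : C.Hom A B} → f C.≈ g → F₁ f D.≈ F₁ g

  F-hid : ∀ {A B} (p : A ≡ B) → F₁ (C.hid p) D.≈ D.hid (cong F₀ p)
  F-hid refl = identity

idF : ∀ {o h} {C : Category o h} → Functor C C
idF {C = C} = record
  { F₀ = λ A → A ; F₁ = λ f → f
  ; identity = ≈.refl ; homomorphism = ≈.refl ; F-resp-≈ = λ e → e }
  where open Category C

infixr 9 _∘F_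
_∘F_ : ∀ {o h o′ h′ o″ h″}
         {C : Category o h} {D : Category o′ h′} {E : Category o″ h″} →
       Functor D E → Functor C D → Functor C E
_∘F_ {E = E} G F = record
  { F₀ = λ A → G.F₀ (F.F₀ A)
  ; F₁ = λ f → G.F₁ (F.F₁ f)
  ; identity = ≈.trans (G.F-resp-≈ F.identity) G.identity
  ; homomorphism = ≈.trans (G.F-resp-≈ F.homomorphism) G.homomorphism
  ; F-resp-≈ = λ e → G.F-resp-≈ (F.F-resp-≈ e) }
  where
    open Category E
    module F = Functor F
    module G = Functor G

record NaturalTransformation {o h o′ h′} {C : Category o h} {D : Category o′ h′}
                             (F G : Functor C D) : Set (o ⊔ h ⊔ h′) where
  private
    module C = Category C
    module D = Category D
    module F = Functor F
    module G = Functor G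
  field
    η       : ∀ A → D.Hom (F.F₀ A) (G.F₀ A)
    commute : ∀ {A B} (f : C.Hom A B) → η B D.∘ F.F₁ f D.≈ G.F₁ f D.∘ η A

module _ {o h o′ h′} {C : Category o h} {D : Category o′ h′} where
  private
    module C = Category C
    module D = Category D
  open Category D using (module HomReasoning)

  idNT : {F : Functor C D} → NaturalTransformation F F
  idNT = record { η = λ _ → D.id ; commute = λ _ → D.id-comm }

  infixr 9 _∘v_
  _∘v_ : {F G H : Functor C D} → NaturalTransformation G H →
         NaturalTransformation F G → NaturalTransformation F H
  _∘v_ {F} {G} {H} β α = record
    { η = λ A → β.η A D.∘ α.η A
    ; commute = λ {A} {B} f → begin
        (β.η B D.∘ α.η B) D.∘ F.F₁ f   ≈⟨ D.assoc ⟩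
        β.η B D.∘ (α.η B D.∘ F.F₁ f)   ≈⟨ D.∘-cong D.≈.refl (α.commute f) ⟩
        β.η B D.∘ (G.F₁ f D.∘ α.η A)   ≈⟨ D.assoc ⟨
        (β.η B D.∘ G.F₁ f) D.∘ α.η A   ≈⟨ D.∘-cong (β.commute f) D.≈.refl ⟩
        (H.F₁ f D.∘ β.η A) D.∘ α.η A   ≈⟨ D.assoc ⟩
        H.F₁ f D.∘ (β.η A D.∘ α.η A)   ∎ }
    where
      open HomReasoning
      module α = NaturalTransformation α
      module β = NaturalTransformation β
      module F = Functor F
      module G = Functor G
      module H = Functor H

  -- Equality of functors as arrows of Cat, not natural isomorphism.
  record _≡F_ (F G : Functor C D) : Set (o ⊔ h ⊔ o′ ⊔ h′) where
    private
      module F = Functor F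
      module G = Functor G
    field
      eq₀ : ∀ A → F.F₀ A ≡ G.F₀ A
      eq₁ : ∀ {A B} (f : C.Hom A B) →
            D.hid (eq₀ B) D.∘ F.F₁ f D.≈ G.F₁ f D.∘ D.hid (eq₀ A)

Functors : ∀ {o h o′ h′} → Category o h → Category o′ h′ →
           Category (o ⊔ h ⊔ o′ ⊔ h′) (o ⊔ h ⊔ h′)
Functors {o} {h} {o′} {h′} C D = record
  { Ob = Functor C D
  ; Hom = NaturalTransformation
  ; _≈_ = λ α β → Lift (o ⊔ h ⊔ h′) (∀ A → η α A D.≈ η β A)
  ; id = idNT
  ; _∘_ = _∘v_
  ; equiv = record
      { refl = lift λ _ → D.≈.refl
      ; sym = λ { (lift e) → lift λ A → D.≈.sym (e A) }
      ; trans = λ { (lift e) (lift e′) → lift λ A → D.≈.trans (e A) (e′ A) } }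
  ; assoc = lift λ _ → D.assoc
  ; idˡ = lift λ _ → D.idˡ
  ; idʳ = lift λ _ → D.idʳ
  ; ∘-cong = λ { (lift e) (lift e′) → lift λ A → D.∘-cong (e A) (e′ A) } }
  where
    module D = Category D
    open NaturalTransformation

record IsEquivalenceOfCategories {o h o′ h′} {C : Category o h} {D : Category o′ h′}
                                 (F : Functor C D) : Set (o ⊔ h ⊔ o′ ⊔ h′) where
  field
    F⁻¹    : Functor D C
    unit   : Category.Iso (Functors C C) idF (F⁻¹ ∘F F)
    counit : Category.Iso (Functors D D) (F ∘F F⁻¹) idF

Sets : ∀ ℓ → Category (lsuc ℓ) ℓ
Sets ℓ = record
  { Ob = Set ℓ
  ; Hom = λ A B → A → B
  ; _≈_ = λ f g → ∀ a → f a ≡ g a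
  ; id = λ a → a
  ; _∘_ = λ g f a → g (f a)
  ; equiv = record
      { refl = λ _ → refl ; sym = λ e a → sym (e a) ; trans = λ e e′ a → trans (e a) (e′ a) }
  ; assoc = λ _ → refl
  ; idˡ = λ _ → refl
  ; idʳ = λ _ → refl
  ; ∘-cong = λ {_} {_} {_} {f} {f′} {g} {g′} e e′ a → trans (cong f (e′ a)) (e (g′ a)) }

Cat : ∀ ℓ → Category (lsuc ℓ) ℓ
Cat ℓ = record
  { Ob = Category ℓ ℓ
  ; Hom = Functor
  ; _≈_ = _≡F_
  ; id = idF
  ; _∘_ = _∘F_
  ; equiv = λ {C} {D} → record
      { refl = record { eq₀ = λ _ → refl ; eq₁ = λ _ → Category.id-comm D }
      ; sym = λ e → record
          { eq₀ = λ A → sym (eq₀ e A)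
          ; eq₁ = λ {A} {B} f → Category.hid-move D (eq₀ e A) (eq₀ e B) (eq₁ e f) }
      ; trans = λ e e′ → ≡F-trans {C} {D} e e′ }
  ; assoc = λ {_} {_} {_} {D} → record { eq₀ = λ _ → refl ; eq₁ = λ _ → Category.id-comm D }
  ; idˡ = λ {_} {D} → record { eq₀ = λ _ → refl ; eq₁ = λ _ → Category.id-comm D }
  ; idʳ = λ {_} {D} → record { eq₀ = λ _ → refl ; eq₁ = λ _ → Category.id-comm D }
  ; ∘-cong = λ {A} {B} {C} {F} {F′} {G} {G′} e e′ → ∘F-cong {A} {B} {C} {F} {F′} {G} {G′} e e′ }
  where
    open _≡F_
    open Functor

    ≡F-trans : {C D : Category ℓ ℓ} {F G H : Functor C D} → F ≡F G → G ≡F H → F ≡F H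
    ≡F-trans {C} {D} {F} {G} {H} e e′ = record
      { eq₀ = λ A → trans (eq₀ e A) (eq₀ e′ A)
      ; eq₁ = λ {A} {B} f → begin
          hid (trans (eq₀ e B) (eq₀ e′ B)) ∘ F₁ F f
            ≈⟨ ∘-cong (hid-trans (eq₀ e B) (eq₀ e′ B)) ≈.refl ⟩
          (hid (eq₀ e′ B) ∘ hid (eq₀ e B)) ∘ F₁ F f  ≈⟨ assoc ⟩
          hid (eq₀ e′ B) ∘ (hid (eq₀ e B) ∘ F₁ F f)  ≈⟨ ∘-cong ≈.refl (eq₁ e f) ⟩
          hid (eq₀ e′ B) ∘ (F₁ G f ∘ hid (eq₀ e A))  ≈⟨ assoc ⟨
          (hid (eq₀ e′ B) ∘ F₁ G f) ∘ hid (eq₀ e A)  ≈⟨ ∘-cong (eq₁ e′ f) ≈.refl ⟩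
          (F₁ H f ∘ hid (eq₀ e′ A)) ∘ hid (eq₀ e A)  ≈⟨ assoc ⟩
          F₁ H f ∘ (hid (eq₀ e′ A) ∘ hid (eq₀ e A))
            ≈⟨ ∘-cong ≈.refl (hid-trans (eq₀ e A) (eq₀ e′ A)) ⟨
          F₁ H f ∘ hid (trans (eq₀ e A) (eq₀ e′ A))  ∎ }
      where
        open Category D
        open HomReasoning

    whiskerˡ : {A B C : Category ℓ ℓ} (F : Functor B C) {G G′ : Functor A B} →
               G ≡F G′ → (F ∘F G) ≡F (F ∘F G′)
    whiskerˡ {A} {B} {C} F {G} {G′} e = record
      { eq₀ = λ X → cong (F₀ F) (eq₀ e X)
      ; eq₁ = λ {X} {Y} f → begin
          hid (cong (F₀ F) (eq₀ e Y)) ∘ F₁ F (F₁ G f)  ≈⟨ ∘-cong (F-hid F (eq₀ e Y)) ≈.refl ⟨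
          F₁ F (B.hid (eq₀ e Y)) ∘ F₁ F (F₁ G f)       ≈⟨ homomorphism F ⟨
          F₁ F (B.hid (eq₀ e Y) B.∘ F₁ G f)            ≈⟨ F-resp-≈ F (eq₁ e f) ⟩
          F₁ F (F₁ G′ f B.∘ B.hid (eq₀ e X))           ≈⟨ homomorphism F ⟩
          F₁ F (F₁ G′ f) ∘ F₁ F (B.hid (eq₀ e X))      ≈⟨ ∘-cong ≈.refl (F-hid F (eq₀ e X)) ⟩
          F₁ F (F₁ G′ f) ∘ hid (cong (F₀ F) (eq₀ e X)) ∎ }
      where
        module B = Category B
        open Category C
        open HomReasoning

    ∘F-cong : {A B C : Category ℓ ℓ} {F F′ : Functor B C} {G G′ : Functor A B} →
              F ≡F F′ → G ≡F G′ → (F ∘F G) ≡F (F′ ∘F G′)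
    ∘F-cong {A} {B} {C} {F} {F′} {G} {G′} e e′ =
      ≡F-trans {A} {C} {F ∘F G} {F′ ∘F G} {F′ ∘F G′}
        (record { eq₀ = λ X → eq₀ e (F₀ G X) ; eq₁ = λ f → eq₁ e (F₁ G f) })
        (whiskerˡ F′ e′)

Disc : ∀ {ℓ} → Functor (Sets ℓ) (Cat ℓ)
Disc {ℓ} = record
  { F₀ = discrete
  ; F₁ = λ f → record
      { F₀ = f
      ; F₁ = cong f
      ; identity = refl
      ; homomorphism = uip _ _
      ; F-resp-≈ = λ _ → uip _ _ }
  ; identity = record { eq₀ = λ _ → refl ; eq₁ = λ _ → uip _ _ }
  ; homomorphism = record { eq₀ = λ _ → refl ; eq₁ = λ _ → uip _ _ }
  ; F-resp-≈ = λ e → record { eq₀ = e ; eq₁ = λ _ → uip _ _ } }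
  where
    discrete : Set ℓ → Category ℓ ℓ
    discrete A = record
      { Ob = A
      ; Hom = _≡_
      ; _≈_ = _≡_
      ; id = refl
      ; _∘_ = λ q p → trans p q
      ; equiv = isEquivalence
      ; assoc = uip _ _
      ; idˡ = uip _ _
      ; idʳ = uip _ _
      ; ∘-cong = λ _ _ → uip _ _ }

record DistributiveCategory (ℓ : Level) : Set (lsuc ℓ) where
  field
    cat : Category ℓ ℓ
  open Category cat public
  infixr 6 _⊕_
  infixr 7 _⊗_
  field
    𝟘 𝟙     : Ob
    _⊕_ _⊗_ : Ob → Ob → Ob
    i₁      : ∀ {A B} → Hom A (A ⊕ B)
    i₂      : ∀ {A B} → Hom B (A ⊕ B)
    π₁      : ∀ {A B} → Hom (A ⊗ B) A
    π₂      : ∀ {A B} → Hom (A ⊗ B) B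
    initial   : IsInitial 𝟘
    terminal  : IsTerminal 𝟙
    coproduct : ∀ {A B} → IsCoproduct (i₁ {A} {B}) i₂
    product   : ∀ {A B} → IsProduct (π₁ {A} {B}) π₂

  distr : ∀ {X Y Z} → Hom (X ⊗ Y ⊕ X ⊗ Z) (X ⊗ (Y ⊕ Z))
  distr = IsCoproduct.[_,_] coproduct
    (IsProduct.⟨_,_⟩ product π₁ (i₁ ∘ π₂)) (IsProduct.⟨_,_⟩ product π₁ (i₂ ∘ π₂))

  field
    distributive : ∀ {X Y Z} → IsIso (distr {X} {Y} {Z})

-- Every sum/product diagram is sent to a sum/product diagram; the operations
-- chosen in a DistributiveCategory play no role.
record PreservesSumsAndProducts {o h o′ h′} {C : Category o h} {D : Category o′ h′}
                                (F : Functor C D) : Set (o ⊔ h ⊔ o′ ⊔ h′) where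
  private
    module C = Category C
    module D = Category D
  open Functor F
  field
    F-initial   : ∀ {Z} → C.IsInitial Z → D.IsInitial (F₀ Z)
    F-terminal  : ∀ {Z} → C.IsTerminal Z → D.IsTerminal (F₀ Z)
    F-coproduct : ∀ {A B S} {i₁ : C.Hom A S} {i₂ : C.Hom B S} →
                  C.IsCoproduct i₁ i₂ → D.IsCoproduct (F₁ i₁) (F₁ i₂)
    F-product   : ∀ {A B P} {π₁ : C.Hom P A} {π₂ : C.Hom P B} →
                  C.IsProduct π₁ π₂ → D.IsProduct (F₁ π₁) (F₁ π₂)

DistributiveFunctor : ∀ {ℓ} → DistributiveCategory ℓ → DistributiveCategory ℓ → Set ℓ
DistributiveFunctor 𝔇 𝔈 = Σ (Functor (cat 𝔇) (cat 𝔈)) PreservesSumsAndProducts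
  where open DistributiveCategory

Dist : ∀ {ℓ} → DistributiveCategory ℓ → DistributiveCategory ℓ → Category ℓ ℓ
Dist 𝔇 𝔈 = record
  { Ob = DistributiveFunctor 𝔇 𝔈
  ; Hom = λ F G → NaturalTransformation (proj₁ F) (proj₁ G)
  ; _≈_ = λ α β → ∀ A → η α A ≈ η β A
  ; id = idNT
  ; _∘_ = _∘v_
  ; equiv = record
      { refl = λ _ → ≈.refl ; sym = λ e A → ≈.sym (e A) ; trans = λ e e′ A → ≈.trans (e A) (e′ A) }
  ; assoc = λ _ → assoc
  ; idˡ = λ _ → idˡ
  ; idʳ = λ _ → idʳ
  ; ∘-cong = λ e e′ A → ∘-cong (e A) (e′ A) }
  where
    open DistributiveCategory 𝔈 using (_≈_; module ≈; assoc; idˡ; idʳ; ∘-cong)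
    open NaturalTransformation

infixr 6 _⊕_
infixr 7 _⊗_
data Expr {ℓ} (A : Set ℓ) : Set ℓ where
  var     : A → Expr A
  𝟘 𝟙     : Expr A
  _⊕_ _⊗_ : Expr A → Expr A → Expr A

T : Set
T = Expr ⊤

pattern 𝕩 = var tt

φ : T → ℕ
φ 𝕩       = 1
φ 𝟘       = 0
φ 𝟙       = 0
φ (t ⊕ u) = φ t + φ u
φ (t ⊗ u) = φ t + φ u

-- The occurrences of the generator in t ⊕ u and t ⊗ u are those in t followed
-- by those in u.
module _ {a} {t u : ℕ} {A : Fin (t + u) → Set a} where
  left : (∀ i → A i) → (∀ i → A (i ↑ˡ u))
  left f i = f (i ↑ˡ u)

  right : (∀ i → A i) → (∀ i → A (t ↑ʳ i))
  right f i = f (t ↑ʳ i)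

infix 8 _[_]
_[_] : ∀ {ℓ} {A : Set ℓ} (t : T) → (Fin (φ t) → A) → Expr A
𝕩       [ a ] = var (a zero)
𝟘       [ a ] = 𝟘
𝟙       [ a ] = 𝟙
(t ⊕ u) [ a ] = t [ left a ] ⊕ u [ right {t = φ t} a ]
(t ⊗ u) [ a ] = t [ left a ] ⊗ u [ right {t = φ t} a ]

data 𝔊-Ob : Set where
  ✶     : 𝔊-Ob
  ⟨_,_⟩ : T → T → 𝔊-Ob

data 𝔊-Hom : 𝔊-Ob → 𝔊-Ob → Set where
  ι  : ∀ {o} → 𝔊-Hom o o
  d  : ∀ {t u} → Fin (φ t) → 𝔊-Hom ⟨ t , u ⟩ ✶
  c  : ∀ {t u} → Fin (φ u) → 𝔊-Hom ⟨ t , u ⟩ ✶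

𝔊 : Category lzero lzero
𝔊 = record
  { Ob = 𝔊-Ob
  ; Hom = 𝔊-Hom
  ; _≈_ = _≡_
  ; id = ι
  ; _∘_ = comp
  ; equiv = isEquivalence
  ; assoc = λ {_} {_} {_} {_} {f} {g} {k} → comp-assoc f g k
  ; idˡ = refl
  ; idʳ = λ {_} {_} {f} → comp-idʳ f
  ; ∘-cong = λ { refl refl → refl } }
  where
    comp : ∀ {x y z} → 𝔊-Hom y z → 𝔊-Hom x y → 𝔊-Hom x z
    comp ι     f = f
    comp (d i) ι = d i
    comp (c j) ι = c j

    comp-idʳ : ∀ {x y} (f : 𝔊-Hom x y) → comp f ι ≡ f
    comp-idʳ ι     = refl
    comp-idʳ (d i) = refl
    comp-idʳ (c j) = refl

    comp-assoc : ∀ {x y z w} (f : 𝔊-Hom x y) (g : 𝔊-Hom y z) (k : 𝔊-Hom z w) →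
                 comp (comp k g) f ≡ comp k (comp g f)
    comp-assoc f g ι     = refl
    comp-assoc ι ι (d i) = refl
    comp-assoc ι ι (c j) = refl

DistributiveGraph : ∀ ℓ → Set (lsuc ℓ)
DistributiveGraph ℓ = Functor 𝔊 (Sets ℓ)

-- Via Cat(Set^𝔊) ≃ Cat^𝔊.
InternalCategory : ∀ ℓ → Set (lsuc ℓ)
InternalCategory ℓ = Functor 𝔊 (Cat ℓ)

-- Strictly natural, since arrows of Cat are compared by _≡F_.
InternalFunctor : ∀ {ℓ} → InternalCategory ℓ → InternalCategory ℓ → Set ℓ
InternalFunctor = NaturalTransformation

-- Families of natural transformations α o : M o ⇒ N o that commute with the
-- actions of the arrows m of 𝔊: the whiskerings α o′ · 𝔸 m and 𝔹 m · α o agree,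
-- modulo the equalities of functors M o′ ∘ 𝔸 m = 𝔹 m ∘ M o, N o′ ∘ 𝔸 m = 𝔹 m ∘ N o.
record InternalNT {ℓ} {𝔸 𝔹 : InternalCategory ℓ} (M N : InternalFunctor 𝔸 𝔹) : Set ℓ where
  private
    module 𝔸 = Functor 𝔸
    module 𝔹 = Functor 𝔹
    module M = NaturalTransformation M
    module N = NaturalTransformation N
  open _≡F_
  field
    α     : ∀ o → NaturalTransformation (M.η o) (N.η o)
    α-nat : ∀ {o o′} (m : 𝔊-Hom o o′) (A : Category.Ob (𝔸.F₀ o)) →
            let open Category (𝔹.F₀ o′); open NaturalTransformation in
            hid (eq₀ (N.commute m) A) ∘ η (α o′) (Functor.F₀ (𝔸.F₁ m) A)
            ≈ Functor.F₁ (𝔹.F₁ m) (η (α o) A) ∘ hid (eq₀ (M.commute m) A)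

  module α (o : 𝔊-Ob) = NaturalTransformation (α o)

module _ {ℓ} {𝔸 𝔹 : InternalCategory ℓ} where
  private
    module 𝔸 = Functor 𝔸
    module 𝔹 = Functor 𝔹
  open InternalNT
  open _≡F_
  open NaturalTransformation

  idINT : {M : InternalFunctor 𝔸 𝔹} → InternalNT M M
  idINT = record
    { α = λ _ → idNT
    ; α-nat = λ {o} {o′} m A → let open Category (𝔹.F₀ o′) in
        ≈.trans (≈.sym id-comm) (∘-cong (≈.sym (Functor.identity (𝔹.F₁ m))) ≈.refl) }

  infixr 9 _∘I_
  _∘I_ : {M N P : InternalFunctor 𝔸 𝔹} → InternalNT N P → InternalNT M N → InternalNT M P
  _∘I_ {M} {N} {P} b a = record
    { α = λ o → α b o ∘v α a o
    ; α-nat = λ {o} {o′} m A →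
        let open Category (𝔹.F₀ o′)
            open HomReasoning
            A′ = Functor.F₀ (𝔸.F₁ m) A
            module B = Functor (𝔹.F₁ m)
        in begin
        hid (eq₀ (commute P m) A) ∘ (η (α b o′) A′ ∘ η (α a o′) A′)   ≈⟨ assoc ⟨
        (hid (eq₀ (commute P m) A) ∘ η (α b o′) A′) ∘ η (α a o′) A′   ≈⟨ ∘-cong (α-nat b m A) ≈.refl ⟩
        (B.F₁ (η (α b o) A) ∘ hid (eq₀ (commute N m) A)) ∘ η (α a o′) A′ ≈⟨ assoc ⟩
        B.F₁ (η (α b o) A) ∘ (hid (eq₀ (commute N m) A) ∘ η (α a o′) A′) ≈⟨ ∘-cong ≈.refl (α-nat a m A) ⟩
        B.F₁ (η (α b o) A) ∘ (B.F₁ (η (α a o) A) ∘ hid (eq₀ (commute M m) A)) ≈⟨ assoc ⟨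
        (B.F₁ (η (α b o) A) ∘ B.F₁ (η (α a o) A)) ∘ hid (eq₀ (commute M m) A)
          ≈⟨ ∘-cong B.homomorphism ≈.refl ⟨
        B.F₁ (Category._∘_ (𝔹.F₀ o) (η (α b o) A) (η (α a o) A)) ∘ hid (eq₀ (commute M m) A) ∎ }

-- Cat(Set^𝔊)(𝔸, 𝔹)
Int : ∀ {ℓ} → InternalCategory ℓ → InternalCategory ℓ → Category ℓ ℓ
Int {ℓ} 𝔸 𝔹 = record
  { Ob = InternalFunctor 𝔸 𝔹
  ; Hom = InternalNT
  ; _≈_ = λ a b → ∀ o A → let open Category (𝔹.F₀ o) in η (α a o) A ≈ η (α b o) A
  ; id = idINT
  ; _∘_ = _∘I_
  ; equiv = record
      { refl = λ o _ → Category.≈.refl (𝔹.F₀ o)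
      ; sym = λ e o A → Category.≈.sym (𝔹.F₀ o) (e o A)
      ; trans = λ e e′ o A → Category.≈.trans (𝔹.F₀ o) (e o A) (e′ o A) }
  ; assoc = λ o _ → Category.assoc (𝔹.F₀ o)
  ; idˡ = λ o _ → Category.idˡ (𝔹.F₀ o)
  ; idʳ = λ o _ → Category.idʳ (𝔹.F₀ o)
  ; ∘-cong = λ e e′ o A → Category.∘-cong (𝔹.F₀ o) (e o A) (e′ o A) }
  where
    module 𝔹 = Functor 𝔹
    open NaturalTransformation
    open InternalNT

precompose : ∀ {ℓ} {𝔸 𝔹 ℂ : InternalCategory ℓ} →
             InternalFunctor 𝔸 𝔹 → Functor (Int 𝔹 ℂ) (Int 𝔸 ℂ)
precompose {ℓ} {𝔸} {𝔹} {ℂ} K = record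
  { F₀ = λ M → M ∘v K
  ; F₁ = whisker
  ; identity = λ o _ → Category.≈.refl (ℂ.F₀ o)
  ; homomorphism = λ o _ → Category.≈.refl (ℂ.F₀ o)
  ; F-resp-≈ = λ e o A → e o (Functor.F₀ (η K o) A) }
  where
    module 𝔸 = Functor 𝔸
    module 𝔹 = Functor 𝔹
    module ℂ = Functor ℂ
    open NaturalTransformation
    open InternalNT
    open _≡F_

    nat-hid : {C D : Category ℓ ℓ} {F G : Functor C D} (β : NaturalTransformation F G) →
              ∀ {X Y} (p : X ≡ Y) → let open Category D in
              hid (cong (Functor.F₀ G) p) ∘ η β X ≈ η β Y ∘ hid (cong (Functor.F₀ F) p)
    nat-hid {D = D} β refl = Category.id-comm D

    whisker : {M N : InternalFunctor 𝔹 ℂ} → InternalNT M N → InternalNT (M ∘v K) (N ∘v K)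
    whisker {M} {N} a = record
      { α = λ o → record
          { η = λ A → η (α a o) (Functor.F₀ (η K o) A)
          ; commute = λ f → commute (α a o) (Functor.F₁ (η K o) f) }
      ; α-nat = λ {o} {o′} m A →
          let open Category (ℂ.F₀ o′)
              open HomReasoning
              KA = Functor.F₀ (η K o) A
              q  = eq₀ (commute K m) A
              pM = eq₀ (commute M m) KA
              pN = eq₀ (commute N m) KA
              M₀ = Functor.F₀ (η M o′)
              N₀ = Functor.F₀ (η N o′)
              X  = Functor.F₀ (η K o′) (Functor.F₀ (𝔸.F₁ m) A)
              Y  = Functor.F₀ (𝔹.F₁ m) KA
              C₁ = Functor.F₁ (ℂ.F₁ m) (η (α a o) KA)
          in begin
          hid (eq₀ (commute (N ∘v K) m) A) ∘ η (α a o′) X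
            ≈⟨ ∘-cong (hid-irr (eq₀ (commute (N ∘v K) m) A) (trans (cong N₀ q) pN)) ≈.refl ⟩
          hid (trans (cong N₀ q) pN) ∘ η (α a o′) X  ≈⟨ ∘-cong (hid-trans (cong N₀ q) pN) ≈.refl ⟩
          (hid pN ∘ hid (cong N₀ q)) ∘ η (α a o′) X  ≈⟨ assoc ⟩
          hid pN ∘ (hid (cong N₀ q) ∘ η (α a o′) X)  ≈⟨ ∘-cong ≈.refl (nat-hid (α a o′) q) ⟩
          hid pN ∘ (η (α a o′) Y ∘ hid (cong M₀ q))  ≈⟨ assoc ⟨
          (hid pN ∘ η (α a o′) Y) ∘ hid (cong M₀ q)  ≈⟨ ∘-cong (α-nat a m KA) ≈.refl ⟩
          (C₁ ∘ hid pM) ∘ hid (cong M₀ q)            ≈⟨ assoc ⟩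
          C₁ ∘ (hid pM ∘ hid (cong M₀ q))            ≈⟨ ∘-cong ≈.refl (hid-trans (cong M₀ q) pM) ⟨
          C₁ ∘ hid (trans (cong M₀ q) pM)
            ≈⟨ ∘-cong ≈.refl (hid-irr (trans (cong M₀ q) pM) (eq₀ (commute (M ∘v K) m) A)) ⟩
          C₁ ∘ hid (eq₀ (commute (M ∘v K) m) A)      ∎ }

module Trees {o h} (C : Category o h) where
  open Category C

  -- `Tree t Xs X` is t_X{Xs}.
  data Tree : (t : T) → (Fin (φ t) → Ob) → Ob → Set (o ⊔ h) where
    gen  : ∀ {Xs} → Tree 𝕩 Xs (Xs zero)
    init : ∀ {Xs Z} → IsInitial Z → Tree 𝟘 Xs Z
    term : ∀ {Xs Z} → IsTerminal Z → Tree 𝟙 Xs Z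
    sum  : ∀ {t u Xs L R S} → Tree t (left Xs) L → Tree u (right {t = φ t} Xs) R →
           {i₁ : Hom L S} {i₂ : Hom R S} → IsCoproduct i₁ i₂ → Tree (t ⊕ u) Xs S
    prod : ∀ {t u Xs L R P} → Tree t (left Xs) L → Tree u (right {t = φ t} Xs) R →
           {π₁ : Hom P L} {π₂ : Hom P R} → IsProduct π₁ π₂ → Tree (t ⊗ u) Xs P

  -- The arrow induced on roots by a tuple of arrows between leaves.
  ⟦_,_⟧ : ∀ {t Xs Xs′ X X′} → Tree t Xs X → Tree t Xs′ X′ →
          (∀ i → Hom (Xs i) (Xs′ i)) → Hom X X′
  ⟦ gen , gen ⟧ f = f zero
  ⟦ init z , init z′ ⟧ f = IsInitial.¡ z
  ⟦ term z , term z′ ⟧ f = IsTerminal.! z′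
  ⟦_,_⟧ {t ⊕ u} (sum l r s) (sum l′ r′ {i₁} {i₂} s′) f =
    IsCoproduct.[_,_] s (i₁ ∘ ⟦ l , l′ ⟧ (left f)) (i₂ ∘ ⟦ r , r′ ⟧ (right {t = φ t} f))
  ⟦_,_⟧ {t ⊗ u} (prod l r {π₁} {π₂} p) (prod l′ r′ p′) f =
    IsProduct.⟨_,_⟩ p′ (⟦ l , l′ ⟧ (left f) ∘ π₁) (⟦ r , r′ ⟧ (right {t = φ t} f) ∘ π₂)

  ⟦⟧-cong : ∀ {t Xs Xs′ X X′} (a : Tree t Xs X) (a′ : Tree t Xs′ X′)
            {f g : ∀ i → Hom (Xs i) (Xs′ i)} → (∀ i → f i ≈ g i) → ⟦ a , a′ ⟧ f ≈ ⟦ a , a′ ⟧ g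
  ⟦⟧-cong gen gen e = e zero
  ⟦⟧-cong (init _) (init _) e = ≈.refl
  ⟦⟧-cong (term _) (term _) e = ≈.refl
  ⟦⟧-cong {t ⊕ u} (sum l r s) (sum l′ r′ s′) e = S.unique
      (≈.trans S.inject₁ (∘-cong ≈.refl (≈.sym (⟦⟧-cong l l′ (left e)))))
      (≈.trans S.inject₂ (∘-cong ≈.refl (≈.sym (⟦⟧-cong r r′ (right {t = φ t} e)))))
    where module S = IsCoproduct s
  ⟦⟧-cong {t ⊗ u} (prod l r p) (prod l′ r′ p′) e = P.unique
      (≈.trans P.project₁ (∘-cong (≈.sym (⟦⟧-cong l l′ (left e))) ≈.refl))
      (≈.trans P.project₂ (∘-cong (≈.sym (⟦⟧-cong r r′ (right {t = φ t} e))) ≈.refl))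
    where module P = IsProduct p′

  ⟦⟧-id : ∀ {t Xs X} (a : Tree t Xs X) → ⟦ a , a ⟧ (λ _ → id) ≈ id
  ⟦⟧-id gen = ≈.refl
  ⟦⟧-id (init z) = IsInitial.¡-unique z id
  ⟦⟧-id (term z) = IsTerminal.!-unique z id
  ⟦⟧-id (sum l r s) = IsCoproduct.unique s
    (≈.trans id-comm (∘-cong ≈.refl (≈.sym (⟦⟧-id l))))
    (≈.trans id-comm (∘-cong ≈.refl (≈.sym (⟦⟧-id r))))
  ⟦⟧-id (prod l r p) = IsProduct.unique p
    (≈.trans (≈.sym id-comm) (∘-cong (≈.sym (⟦⟧-id l)) ≈.refl))
    (≈.trans (≈.sym id-comm) (∘-cong (≈.sym (⟦⟧-id r)) ≈.refl))

  private
    square : ∀ {A A′ A″ B B′ B″} {i : Hom A B} {i′ : Hom A′ B′} {i″ : Hom A″ B″}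
             {f : Hom A A′} {f′ : Hom A′ A″} {k : Hom B B′} {k′ : Hom B′ B″} →
             k ∘ i ≈ i′ ∘ f → k′ ∘ i′ ≈ i″ ∘ f′ → (k′ ∘ k) ∘ i ≈ i″ ∘ (f′ ∘ f)
    square {i = i} {i′} {i″} {f} {f′} {k} {k′} e e′ = begin
      (k′ ∘ k) ∘ i   ≈⟨ assoc ⟩
      k′ ∘ (k ∘ i)   ≈⟨ ∘-cong ≈.refl e ⟩
      k′ ∘ (i′ ∘ f)  ≈⟨ assoc ⟨
      (k′ ∘ i′) ∘ f  ≈⟨ ∘-cong e′ ≈.refl ⟩
      (i″ ∘ f′) ∘ f  ≈⟨ assoc ⟩
      i″ ∘ (f′ ∘ f)  ∎
      where open HomReasoning

  ⟦⟧-∘ : ∀ {t Xs Xs′ Xs″ X X′ X″}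
         (a : Tree t Xs X) (a′ : Tree t Xs′ X′) (a″ : Tree t Xs″ X″)
         {f : ∀ i → Hom (Xs i) (Xs′ i)} {g : ∀ i → Hom (Xs′ i) (Xs″ i)} →
         ⟦ a , a″ ⟧ (λ i → g i ∘ f i) ≈ ⟦ a′ , a″ ⟧ g ∘ ⟦ a , a′ ⟧ f
  ⟦⟧-∘ gen gen gen = ≈.refl
  ⟦⟧-∘ (init z) (init _) (init _) = IsInitial.¡-unique z _
  ⟦⟧-∘ (term _) (term _) (term z) = IsTerminal.!-unique z _
  ⟦⟧-∘ (sum l r s) (sum l′ r′ s′) (sum l″ r″ s″) = S.unique
      (≈.trans (square S.inject₁ S′.inject₁) (∘-cong ≈.refl (≈.sym (⟦⟧-∘ l l′ l″))))
      (≈.trans (square S.inject₂ S′.inject₂) (∘-cong ≈.refl (≈.sym (⟦⟧-∘ r r′ r″))))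
    where
      module S = IsCoproduct s
      module S′ = IsCoproduct s′
  ⟦⟧-∘ (prod l r p) (prod l′ r′ p′) (prod l″ r″ p″) = P″.unique
      (≈.trans (≈.sym (square (≈.sym P′.project₁) (≈.sym P″.project₁)))
               (∘-cong (≈.sym (⟦⟧-∘ l l′ l″)) ≈.refl))
      (≈.trans (≈.sym (square (≈.sym P′.project₂) (≈.sym P″.project₂)))
               (∘-cong (≈.sym (⟦⟧-∘ r r′ r″)) ≈.refl))
    where
      module P′ = IsProduct p′
      module P″ = IsProduct p″

open Trees

module _ {o h o′ h′} {C : Category o h} {D : Category o′ h′} where
  private
    module C = Category C
    module D = Category D

  mapTree : (F : Functor C D) → PreservesSumsAndProducts F → (let open Functor F) →
            ∀ {t Xs X} → Tree C t Xs X → Tree D t (λ i → F₀ (Xs i)) (F₀ X)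
  mapTree F pres gen = gen
  mapTree F pres (init z) = init (PreservesSumsAndProducts.F-initial pres z)
  mapTree F pres (term z) = term (PreservesSumsAndProducts.F-terminal pres z)
  mapTree F pres (sum l r s) =
    sum (mapTree F pres l) (mapTree F pres r) (PreservesSumsAndProducts.F-coproduct pres s)
  mapTree F pres (prod l r p) =
    prod (mapTree F pres l) (mapTree F pres r) (PreservesSumsAndProducts.F-product pres p)

  module _ (F : Functor C D) (pres : PreservesSumsAndProducts F) where
    open Functor F
    open PreservesSumsAndProducts pres

    private
      F-square : ∀ {X Y Z W} {f : C.Hom X Y} {g : C.Hom Y Z} {k : C.Hom X W} {l : C.Hom W Z} →
                 g C.∘ f C.≈ l C.∘ k → F₁ g D.∘ F₁ f D.≈ F₁ l D.∘ F₁ k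
      F-square e = D.≈.trans (D.≈.sym homomorphism) (D.≈.trans (F-resp-≈ e) homomorphism)

    map-⟦⟧ : ∀ {t Xs Xs′ X X′} (a : Tree C t Xs X) (a′ : Tree C t Xs′ X′)
             {f : ∀ i → C.Hom (Xs i) (Xs′ i)} →
             ⟦_,_⟧ D (mapTree F pres a) (mapTree F pres a′) (λ i → F₁ (f i))
             D.≈ F₁ (⟦_,_⟧ C a a′ f)
    map-⟦⟧ gen gen = D.≈.refl
    map-⟦⟧ (init z) (init _) = D.IsInitial.¡-unique (F-initial z) _
    map-⟦⟧ (term _) (term z) = D.IsTerminal.!-unique (F-terminal z) _
    map-⟦⟧ (sum l r s) (sum l′ r′ s′) = D.IsCoproduct.unique (F-coproduct s)
      (D.≈.trans (F-square (C.IsCoproduct.inject₁ s))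
                 (D.∘-cong D.≈.refl (D.≈.sym (map-⟦⟧ l l′))))
      (D.≈.trans (F-square (C.IsCoproduct.inject₂ s))
                 (D.∘-cong D.≈.refl (D.≈.sym (map-⟦⟧ r r′))))
    map-⟦⟧ (prod l r p) (prod l′ r′ p′) = D.IsProduct.unique (F-product p′)
      (D.≈.trans (F-square (C.IsProduct.project₁ p′))
                 (D.∘-cong (D.≈.sym (map-⟦⟧ l l′)) D.≈.refl))
      (D.≈.trans (F-square (C.IsProduct.project₂ p′))
                 (D.∘-cong (D.≈.sym (map-⟦⟧ r r′)) D.≈.refl))

  nat-⟦⟧ : {F G : Functor C D} (presF : PreservesSumsAndProducts F)
           (presG : PreservesSumsAndProducts G) (α : NaturalTransformation F G) →
           (let open NaturalTransformation α) →
           ∀ {t Xs X} (a : Tree C t Xs X) →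
           ⟦_,_⟧ D (mapTree F presF a) (mapTree G presG a) (λ i → η (Xs i)) D.≈ η X
  nat-⟦⟧ presF presG α gen = D.≈.refl
  nat-⟦⟧ presF presG α (init z) =
    D.IsInitial.¡-unique (PreservesSumsAndProducts.F-initial presF z) _
  nat-⟦⟧ presF presG α (term z) =
    D.IsTerminal.!-unique (PreservesSumsAndProducts.F-terminal presG z) _
  nat-⟦⟧ presF presG α (sum l r s) =
    D.IsCoproduct.unique (PreservesSumsAndProducts.F-coproduct presF s)
      (D.≈.trans (commute _) (D.∘-cong D.≈.refl (D.≈.sym (nat-⟦⟧ presF presG α l))))
      (D.≈.trans (commute _) (D.∘-cong D.≈.refl (D.≈.sym (nat-⟦⟧ presF presG α r))))
    where open NaturalTransformation α
  nat-⟦⟧ presF presG α (prod l r p) =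
    D.IsProduct.unique (PreservesSumsAndProducts.F-product presG p)
      (D.≈.trans (D.≈.sym (commute _)) (D.∘-cong (D.≈.sym (nat-⟦⟧ presF presG α l)) D.≈.refl))
      (D.≈.trans (D.≈.sym (commute _)) (D.∘-cong (D.≈.sym (nat-⟦⟧ presF presG α r)) D.≈.refl))
    where open NaturalTransformation α

module _ {ℓ} (C : Category ℓ ℓ) (t u : T) where
  open Category C

  record Arc : Set ℓ where
    constructor mkArc
    field
      {X Y} : Ob
      {Xs}  : Fin (φ t) → Ob
      {Ys}  : Fin (φ u) → Ob
      arrow : Hom X Y
      src   : Tree C t Xs X
      tgt   : Tree C u Ys Y

  record ArcHom (a a′ : Arc) : Set ℓ where
    private
      module a = Arc a
      module a′ = Arc a′
    field
      fs     : ∀ i → Hom (a.Xs i) (a′.Xs i)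
      gs     : ∀ j → Hom (a.Ys j) (a′.Ys j)
      square : ⟦_,_⟧ C a.tgt a′.tgt gs ∘ a.arrow ≈ a′.arrow ∘ ⟦_,_⟧ C a.src a′.src fs

  open ArcHom

  Arcs : Category ℓ ℓ
  Arcs = record
    { Ob = Arc
    ; Hom = ArcHom
    ; _≈_ = λ k l → (∀ i → fs k i ≈ fs l i) × (∀ j → gs k j ≈ gs l j)
    ; id = λ {a} → record
        { fs = λ _ → id
        ; gs = λ _ → id
        ; square = ≈.trans (∘-cong (⟦⟧-id C (Arc.tgt a)) ≈.refl)
                  (≈.trans id-comm (∘-cong ≈.refl (≈.sym (⟦⟧-id C (Arc.src a))))) }
    ; _∘_ = compose
    ; equiv = record
        { refl = (λ _ → ≈.refl) , (λ _ → ≈.refl)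
        ; sym = λ (e , e′) → (λ i → ≈.sym (e i)) , (λ j → ≈.sym (e′ j))
        ; trans = λ (e , e′) (k , k′) →
            (λ i → ≈.trans (e i) (k i)) , (λ j → ≈.trans (e′ j) (k′ j)) }
    ; assoc = (λ _ → assoc) , (λ _ → assoc)
    ; idˡ = (λ _ → idˡ) , (λ _ → idˡ)
    ; idʳ = (λ _ → idʳ) , (λ _ → idʳ)
    ; ∘-cong = λ (e , e′) (k , k′) →
        (λ i → ∘-cong (e i) (k i)) , (λ j → ∘-cong (e′ j) (k′ j)) }
    where
      compose : ∀ {a a′ a″} → ArcHom a′ a″ → ArcHom a a′ → ArcHom a a″
      compose {a} {a′} {a″} k l = record
        { fs = λ i → fs k i ∘ fs l i
        ; gs = λ j → gs k j ∘ gs l j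
        ; square = begin
            ⟦_,_⟧ C a.tgt a″.tgt (λ j → gs k j ∘ gs l j) ∘ a.arrow
              ≈⟨ ∘-cong (⟦⟧-∘ C a.tgt a′.tgt a″.tgt) ≈.refl ⟩
            (⟦_,_⟧ C a′.tgt a″.tgt (gs k) ∘ ⟦_,_⟧ C a.tgt a′.tgt (gs l)) ∘ a.arrow  ≈⟨ assoc ⟩
            ⟦_,_⟧ C a′.tgt a″.tgt (gs k) ∘ (⟦_,_⟧ C a.tgt a′.tgt (gs l) ∘ a.arrow)
              ≈⟨ ∘-cong ≈.refl (square l) ⟩
            ⟦_,_⟧ C a′.tgt a″.tgt (gs k) ∘ (a′.arrow ∘ ⟦_,_⟧ C a.src a′.src (fs l))  ≈⟨ assoc ⟨
            (⟦_,_⟧ C a′.tgt a″.tgt (gs k) ∘ a′.arrow) ∘ ⟦_,_⟧ C a.src a′.src (fs l)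
              ≈⟨ ∘-cong (square k) ≈.refl ⟩
            (a″.arrow ∘ ⟦_,_⟧ C a′.src a″.src (fs k)) ∘ ⟦_,_⟧ C a.src a′.src (fs l)  ≈⟨ assoc ⟩
            a″.arrow ∘ (⟦_,_⟧ C a′.src a″.src (fs k) ∘ ⟦_,_⟧ C a.src a′.src (fs l))
              ≈⟨ ∘-cong ≈.refl (⟦⟧-∘ C a.src a′.src a″.src) ⟨
            a″.arrow ∘ ⟦_,_⟧ C a.src a″.src (λ i → fs k i ∘ fs l i) ∎ }
        where
          open HomReasoning
          module a = Arc a
          module a′ = Arc a′
          module a″ = Arc a″

  domF : Fin (φ t) → Functor Arcs C
  domF i = record
    { F₀ = λ a → Arc.Xs a i ; F₁ = λ k → fs k i
    ; identity = ≈.refl ; homomorphism = ≈.refl ; F-resp-≈ = λ e → proj₁ e i }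

  codF : Fin (φ u) → Functor Arcs C
  codF j = record
    { F₀ = λ a → Arc.Ys a j ; F₁ = λ k → gs k j
    ; identity = ≈.refl ; homomorphism = ≈.refl ; F-resp-≈ = λ e → proj₂ e j }

open ArcHom

module _ {ℓ} (𝔇 : DistributiveCategory ℓ) where
  open DistributiveCategory 𝔇 using (cat)

  𝒰 : InternalCategory ℓ
  𝒰 = record
    { F₀ = U₀
    ; F₁ = U₁
    ; identity = λ {o} → Category.≈.refl (Cat ℓ) {U₀ o} {U₀ o} {idF}
    ; homomorphism = λ {_} {_} {_} {f} {g} → U-∘ f g
    ; F-resp-≈ = λ {o} {o′} {f} → λ { refl → Category.≈.refl (Cat ℓ) {U₀ o} {U₀ o′} {U₁ f} } }
    where
      U₀ : 𝔊-Ob → Category ℓ ℓ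
      U₀ ✶ = cat
      U₀ ⟨ t , u ⟩ = Arcs cat t u

      U₁ : ∀ {o o′} → 𝔊-Hom o o′ → Functor (U₀ o) (U₀ o′)
      U₁ ι = idF
      U₁ (d {t} {u} i) = domF cat t u i
      U₁ (c {t} {u} j) = codF cat t u j

      U-∘ : ∀ {x y z} (f : 𝔊-Hom x y) (g : 𝔊-Hom y z) →
            U₁ (Category._∘_ 𝔊 g f) ≡F (U₁ g ∘F U₁ f)
      U-∘ {x} {y} f ι = record { eq₀ = λ _ → refl ; eq₁ = λ _ → Category.id-comm (U₀ y) }
      U-∘ ι (d i) = record { eq₀ = λ _ → refl ; eq₁ = λ _ → Category.id-comm cat }
      U-∘ ι (c j) = record { eq₀ = λ _ → refl ; eq₁ = λ _ → Category.id-comm cat }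

module _ {ℓ} {𝔇 𝔈 : DistributiveCategory ℓ} where
  private
    module 𝔇 = DistributiveCategory 𝔇
    module 𝔈 = DistributiveCategory 𝔈
    module UE = Functor (𝒰 𝔈)
    open NaturalTransformation

  𝒰-functor : DistributiveFunctor 𝔇 𝔈 → InternalFunctor (𝒰 𝔇) (𝒰 𝔈)
  𝒰-functor (F , pres) = record { η = component ; commute = strict }
    where
      open Functor F

      onArc : ∀ {t u} → Arc 𝔇.cat t u → Arc 𝔈.cat t u
      onArc (mkArc f a b) = mkArc (F₁ f) (mapTree F pres a) (mapTree F pres b)

      component : ∀ o → Functor (Functor.F₀ (𝒰 𝔇) o) (UE.F₀ o)
      component ✶ = F
      component ⟨ t , u ⟩ = record
        { F₀ = onArc
        ; F₁ = λ {a} {a′} k →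
            let open Category 𝔈.cat
                open HomReasoning
                module a = Arc a
                module a′ = Arc a′
            in record
            { fs = λ i → F₁ (fs k i)
            ; gs = λ j → F₁ (gs k j)
            ; square = begin
                ⟦_,_⟧ 𝔈.cat (mapTree F pres a.tgt) (mapTree F pres a′.tgt) (λ j → F₁ (gs k j)) ∘ F₁ a.arrow
                  ≈⟨ ∘-cong (map-⟦⟧ F pres a.tgt a′.tgt) ≈.refl ⟩
                F₁ (⟦_,_⟧ 𝔇.cat a.tgt a′.tgt (gs k)) ∘ F₁ a.arrow  ≈⟨ homomorphism ⟨
                F₁ (⟦_,_⟧ 𝔇.cat a.tgt a′.tgt (gs k) 𝔇.∘ a.arrow)   ≈⟨ F-resp-≈ (square k) ⟩
                F₁ (a′.arrow 𝔇.∘ ⟦_,_⟧ 𝔇.cat a.src a′.src (fs k))  ≈⟨ homomorphism ⟩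
                F₁ a′.arrow ∘ F₁ (⟦_,_⟧ 𝔇.cat a.src a′.src (fs k))
                  ≈⟨ ∘-cong ≈.refl (map-⟦⟧ F pres a.src a′.src) ⟨
                F₁ a′.arrow ∘ ⟦_,_⟧ 𝔈.cat (mapTree F pres a.src) (mapTree F pres a′.src) (λ i → F₁ (fs k i)) ∎ }
        ; identity = (λ _ → identity) , (λ _ → identity)
        ; homomorphism = (λ _ → homomorphism) , (λ _ → homomorphism)
        ; F-resp-≈ = λ (e , e′) → (λ i → F-resp-≈ (e i)) , (λ j → F-resp-≈ (e′ j)) }

      strict : ∀ {o o′} (m : 𝔊-Hom o o′) →
               (component o′ ∘F Functor.F₁ (𝒰 𝔇) m) ≡F (UE.F₁ m ∘F component o)
      strict {o} ι = record { eq₀ = λ _ → refl ; eq₁ = λ _ → Category.id-comm (UE.F₀ o) }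
      strict (d i) = record { eq₀ = λ _ → refl ; eq₁ = λ _ → 𝔈.id-comm }
      strict (c j) = record { eq₀ = λ _ → refl ; eq₁ = λ _ → 𝔈.id-comm }

  𝒰-nat : {F G : DistributiveFunctor 𝔇 𝔈} → NaturalTransformation (proj₁ F) (proj₁ G) →
          InternalNT (𝒰-functor F) (𝒰-functor G)
  𝒰-nat {F , presF} {G , presG} β = record { α = component ; α-nat = compatible }
    where
      module G = Functor G

      component : ∀ o → NaturalTransformation (η (𝒰-functor (F , presF)) o) (η (𝒰-functor (G , presG)) o)
      component ✶ = β
      component ⟨ t , u ⟩ = record
        { η = λ a →
            let open Category 𝔈.cat
                module a = Arc a
            in record
            { fs = λ i → η β (a.Xs i)
            ; gs = λ j → η β (a.Ys j)
            ; square = ≈.trans (∘-cong (nat-⟦⟧ presF presG β a.tgt) ≈.refl)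
                      (≈.trans (commute β a.arrow)
                               (∘-cong ≈.refl (≈.sym (nat-⟦⟧ presF presG β a.src)))) }
        ; commute = λ k → (λ i → commute β (fs k i)) , (λ j → commute β (gs k j)) }

      compatible : ∀ {o o′} (m : 𝔊-Hom o o′) A → let open Category (UE.F₀ o′) in
                   hid (_≡F_.eq₀ (commute (𝒰-functor (G , presG)) m) A)
                     ∘ η (component o′) (Functor.F₀ (Functor.F₁ (𝒰 𝔇) m) A)
                   ≈ Functor.F₁ (UE.F₁ m) (η (component o) A)
                     ∘ hid (_≡F_.eq₀ (commute (𝒰-functor (F , presF)) m) A)
      compatible {o} ι A = Category.id-comm (UE.F₀ o)
      compatible (d i) A = 𝔈.id-comm
      compatible (c j) A = 𝔈.id-comm

-- 𝒰(−) : Dist(𝔇, 𝔈) → Cat(Set^𝔊)(𝒰 𝔇, 𝒰 𝔈)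
𝒰₁ : ∀ {ℓ} (𝔇 𝔈 : DistributiveCategory ℓ) → Functor (Dist 𝔇 𝔈) (Int (𝒰 𝔇) (𝒰 𝔈))
𝒰₁ 𝔇 𝔈 = record
  { F₀ = 𝒰-functor
  ; F₁ = 𝒰-nat
  ; identity = λ { ✶ _ → 𝔈.≈.refl ; ⟨ _ , _ ⟩ _ → (λ _ → 𝔈.≈.refl) , (λ _ → 𝔈.≈.refl) }
  ; homomorphism = λ { ✶ _ → 𝔈.≈.refl ; ⟨ _ , _ ⟩ _ → (λ _ → 𝔈.≈.refl) , (λ _ → 𝔈.≈.refl) }
  ; F-resp-≈ = λ { e ✶ A → e A
                 ; e ⟨ _ , _ ⟩ a → (λ i → e (Arc.Xs a i)) , (λ j → e (Arc.Ys a j)) } }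
  where module 𝔈 = DistributiveCategory 𝔈

module _ {ℓ} (G : DistributiveGraph ℓ) where
  private module G = Functor G

  infixr 9 _∘ᶠ_
  data Arrow : Expr (G.F₀ ✶) → Expr (G.F₀ ✶) → Set ℓ where
    arc   : ∀ {t u} (a : G.F₀ ⟨ t , u ⟩) →
            Arrow (t [ (λ i → G.F₁ (d i) a) ]) (u [ (λ j → G.F₁ (c j) a) ])
    idᶠ   : ∀ {X} → Arrow X X
    _∘ᶠ_  : ∀ {X Y Z} → Arrow Y Z → Arrow X Y → Arrow X Z
    inj₁  : ∀ {X Y} → Arrow X (X ⊕ Y)
    inj₂  : ∀ {X Y} → Arrow Y (X ⊕ Y)
    prj₁  : ∀ {X Y} → Arrow (X ⊗ Y) X
    prj₂  : ∀ {X Y} → Arrow (X ⊗ Y) Y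
    ¡ᶠ    : ∀ {X} → Arrow 𝟘 X
    !ᶠ    : ∀ {X} → Arrow X 𝟙
    δ⁻¹   : ∀ {X Y Z} → Arrow (X ⊗ (Y ⊕ Z)) (X ⊗ Y ⊕ X ⊗ Z)
    ⦅_∣_⦆ : ∀ {X Y Z} → Arrow X Z → Arrow Y Z → Arrow (X ⊕ Y) Z
    ⦅_,_⦆ : ∀ {X Y Z} → Arrow Z X → Arrow Z Y → Arrow Z (X ⊗ Y)

  δ : ∀ {X Y Z} → Arrow (X ⊗ Y ⊕ X ⊗ Z) (X ⊗ (Y ⊕ Z))
  δ = ⦅ ⦅ prj₁ , inj₁ ∘ᶠ prj₂ ⦆ ∣ ⦅ prj₁ , inj₂ ∘ᶠ prj₂ ⦆ ⦆

  infix 4 _≈ᶠ_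
  data _≈ᶠ_ : ∀ {X Y} → Arrow X Y → Arrow X Y → Set ℓ where
    reflᶠ   : ∀ {X Y} {f : Arrow X Y} → f ≈ᶠ f
    symᶠ    : ∀ {X Y} {f g : Arrow X Y} → f ≈ᶠ g → g ≈ᶠ f
    transᶠ  : ∀ {X Y} {f g k : Arrow X Y} → f ≈ᶠ g → g ≈ᶠ k → f ≈ᶠ k
    ∘ᶠ-cong : ∀ {X Y Z} {f f′ : Arrow Y Z} {g g′ : Arrow X Y} →
              f ≈ᶠ f′ → g ≈ᶠ g′ → f ∘ᶠ g ≈ᶠ f′ ∘ᶠ g′
    assocᶠ  : ∀ {X Y Z W} {f : Arrow X Y} {g : Arrow Y Z} {k : Arrow Z W} →
              (k ∘ᶠ g) ∘ᶠ f ≈ᶠ k ∘ᶠ (g ∘ᶠ f)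
    idˡᶠ    : ∀ {X Y} {f : Arrow X Y} → idᶠ ∘ᶠ f ≈ᶠ f
    idʳᶠ    : ∀ {X Y} {f : Arrow X Y} → f ∘ᶠ idᶠ ≈ᶠ f
    -- The following rules subsume congruence of copairing and pairing.
    +-β₁    : ∀ {X Y Z} {f : Arrow X Z} {g : Arrow Y Z} → ⦅ f ∣ g ⦆ ∘ᶠ inj₁ ≈ᶠ f
    +-β₂    : ∀ {X Y Z} {f : Arrow X Z} {g : Arrow Y Z} → ⦅ f ∣ g ⦆ ∘ᶠ inj₂ ≈ᶠ g
    +-uniq  : ∀ {X Y Z} {f : Arrow X Z} {g : Arrow Y Z} {k : Arrow (X ⊕ Y) Z} →
              k ∘ᶠ inj₁ ≈ᶠ f → k ∘ᶠ inj₂ ≈ᶠ g → ⦅ f ∣ g ⦆ ≈ᶠ k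
    ×-β₁    : ∀ {X Y Z} {f : Arrow Z X} {g : Arrow Z Y} → prj₁ ∘ᶠ ⦅ f , g ⦆ ≈ᶠ f
    ×-β₂    : ∀ {X Y Z} {f : Arrow Z X} {g : Arrow Z Y} → prj₂ ∘ᶠ ⦅ f , g ⦆ ≈ᶠ g
    ×-uniq  : ∀ {X Y Z} {f : Arrow Z X} {g : Arrow Z Y} {k : Arrow Z (X ⊗ Y)} →
              prj₁ ∘ᶠ k ≈ᶠ f → prj₂ ∘ᶠ k ≈ᶠ g → ⦅ f , g ⦆ ≈ᶠ k
    ¡-uniq  : ∀ {X} (f : Arrow 𝟘 X) → ¡ᶠ ≈ᶠ f
    !-uniq  : ∀ {X} (f : Arrow X 𝟙) → !ᶠ ≈ᶠ f
    δ⁻¹-δ   : ∀ {X Y Z} → δ⁻¹ {X} {Y} {Z} ∘ᶠ δ ≈ᶠ idᶠ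
    δ-δ⁻¹   : ∀ {X Y Z} → δ {X} {Y} {Z} ∘ᶠ δ⁻¹ ≈ᶠ idᶠ

  ℱ : DistributiveCategory ℓ
  ℱ = record
    { cat = record
        { Ob = Expr (G.F₀ ✶)
        ; Hom = Arrow
        ; _≈_ = _≈ᶠ_
        ; id = idᶠ
        ; _∘_ = _∘ᶠ_
        ; equiv = record { refl = reflᶠ ; sym = symᶠ ; trans = transᶠ }
        ; assoc = assocᶠ ; idˡ = idˡᶠ ; idʳ = idʳᶠ ; ∘-cong = ∘ᶠ-cong }
    ; 𝟘 = 𝟘 ; 𝟙 = 𝟙 ; _⊕_ = _⊕_ ; _⊗_ = _⊗_
    ; i₁ = inj₁ ; i₂ = inj₂ ; π₁ = prj₁ ; π₂ = prj₂
    ; initial = record { ¡ = ¡ᶠ ; ¡-unique = ¡-uniq }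
    ; terminal = record { ! = !ᶠ ; !-unique = !-uniq }
    ; coproduct = record
        { [_,_] = ⦅_∣_⦆ ; inject₁ = +-β₁ ; inject₂ = +-β₂ ; unique = +-uniq }
    ; product = record
        { ⟨_,_⟩ = ⦅_,_⦆ ; project₁ = ×-β₁ ; project₂ = ×-β₂ ; unique = ×-uniq }
    ; distributive = record { inv = δ⁻¹ ; invˡ = δ⁻¹-δ ; invʳ = δ-δ⁻¹ } }

  private module ℱ = DistributiveCategory ℱ

  chosenTree : ∀ t (A : Fin (φ t) → G.F₀ ✶) → Tree ℱ.cat t (λ i → var (A i)) (t [ A ])
  chosenTree 𝕩 A = gen
  chosenTree 𝟘 A = init ℱ.initial
  chosenTree 𝟙 A = term ℱ.terminal
  chosenTree (t ⊕ u) A =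
    sum (chosenTree t (left A)) (chosenTree u (right {t = φ t} A)) ℱ.coproduct
  chosenTree (t ⊗ u) A =
    prod (chosenTree t (left A)) (chosenTree u (right {t = φ t} A)) ℱ.product

  -- G as a discrete internal category
  discrete : InternalCategory ℓ
  discrete = Disc ∘F G

  -- η_G
  unit : InternalFunctor discrete (𝒰 ℱ)
  unit = record { η = component ; commute = strict }
    where
      module U = Functor (𝒰 ℱ)

      onOb : ∀ o → G.F₀ o → Category.Ob (U.F₀ o)
      onOb ✶ A = var A
      onOb ⟨ t , u ⟩ a = mkArc (arc a) (chosenTree t _) (chosenTree u _)

      component : ∀ o → Functor (Functor.F₀ discrete o) (U.F₀ o)
      component o = record
        { F₀ = onOb o
        ; F₁ = λ p → hid (cong (onOb o) p)
        ; identity = ≈.refl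
        ; homomorphism = λ { {f = refl} {refl} → ≈.sym idˡ }
        ; F-resp-≈ = λ { refl → ≈.refl } }
        where open Category (U.F₀ o)

      strict : ∀ {o o′} (m : 𝔊-Hom o o′) →
               (component o′ ∘F Functor.F₁ discrete m) ≡F (U.F₁ m ∘F component o)
      strict {o} ι = record
        { eq₀ = λ a → cong (onOb o) (G.identity a)
        ; eq₁ = λ { refl → Category.≈.sym (U.F₀ o) (Category.id-comm (U.F₀ o)) } }
      strict (d i) = record { eq₀ = λ _ → refl ; eq₁ = λ { refl → ℱ.id-comm } }
      strict (c j) = record { eq₀ = λ _ → refl ; eq₁ = λ { refl → ℱ.id-comm } }

{-# OPTIONS --safe #-}
module Submission where

-- Restriction along η_G is fully faithful and essentially surjective.  Every
-- object of ℱ G is a finite sum/product of generators, so a natural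
-- transformation between distributive functors is determined by its components
-- at the generators; conversely, a family of such components extends along the
-- preserved sums and products, and the extension is natural once it is natural
-- at the arcs, which is what the squares of arc morphisms in 𝒰 𝔇 say.  An
-- internal functor M : G → 𝒰 𝔇 is hit, up to isomorphism, by the interpretation
-- of ℱ G in the chosen structure of 𝔇, where an arc goes to the arrow of its
-- image under M conjugated by the canonical isomorphisms from the chosen sums
-- and products to the ones recorded in the trees of that image.

open import Defs
open Trees
open ArcHom
open import Data.Fin.Base using (Fin)
open import Data.Product.Base using (Σ; _,_; proj₁; proj₂)
open import Level using (lift)
open import Relation.Binary.PropositionalEquality.Core using (_≡_; refl; cong₂)

-- Isomorphisms and universal diagrams in a category.

module _ {o h} (C : Category o h) where
  open Category C
  open HomReasoning

  hid-isIso : ∀ {A B} (p : A ≡ B) → IsIso (hid p)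
  hid-isIso refl = record { inv = id ; invˡ = idˡ ; invʳ = idˡ }

  hid-loop : ∀ {A} (p : A ≡ A) → hid p ≈ id
  hid-loop p = hid-irr p refl

  -- Once the indices are identified, `p` and `q` are loops, whose `hid` is an identity by
  -- uniqueness of identity proofs. They stay arbitrary so that the strictness proofs of any
  -- internal functor can be supplied.
  hid-family : ∀ {i} {I : Set i} {F G : I → Ob} (α : ∀ x → Hom (F x) (G x)) {x y : I} → x ≡ y →
               (p : F x ≡ F y) (q : G x ≡ G y) → hid q ∘ α x ≈ α y ∘ hid p
  hid-family α refl p q = ≈.trans (∘-cong (hid-loop q) ≈.refl)
    (≈.trans id-comm (∘-cong ≈.refl (≈.sym (hid-loop p))))

  cancelˡ : ∀ {A B X} {f : Hom A B} {f⁻¹ : Hom B A} {g : Hom X A} →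
            f⁻¹ ∘ f ≈ id → f⁻¹ ∘ (f ∘ g) ≈ g
  cancelˡ e = ≈.trans (≈.sym assoc) (≈.trans (∘-cong e ≈.refl) idˡ)

  cancelʳ : ∀ {A B X} {f : Hom A B} {f⁻¹ : Hom B A} {g : Hom B X} →
            f ∘ f⁻¹ ≈ id → (g ∘ f) ∘ f⁻¹ ≈ g
  cancelʳ e = ≈.trans assoc (≈.trans (∘-cong ≈.refl e) idʳ)

  -- Insert `j.inv ∘ g` on the left and cancel `f ∘ i.inv` on the right. Inverses of natural
  -- transformations, of arc morphisms and of internal transformations all get their squares from
  -- this, and so does naturality at `δ⁻¹`.
  invert-square : ∀ {A A′ B B′} {f : Hom A A′} {g : Hom B B′} {k : Hom A B} {k′ : Hom A′ B′}
                  (i : IsIso f) (j : IsIso g) →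
                  g ∘ k ≈ k′ ∘ f → k ∘ IsIso.inv i ≈ IsIso.inv j ∘ k′
  invert-square {f = f} {g} {k} {k′} i j e = begin
    k ∘ i.inv                    ≈⟨ ∘-cong (cancelˡ j.invˡ) ≈.refl ⟨
    (j.inv ∘ (g ∘ k)) ∘ i.inv    ≈⟨ assoc ⟩
    j.inv ∘ ((g ∘ k) ∘ i.inv)    ≈⟨ ∘-cong ≈.refl (∘-cong e ≈.refl) ⟩
    j.inv ∘ ((k′ ∘ f) ∘ i.inv)   ≈⟨ ∘-cong ≈.refl (cancelʳ i.invʳ) ⟩
    j.inv ∘ k′                   ∎
    where
      module i = IsIso i
      module j = IsIso j

  module _ {A B S} {i₁ : Hom A S} {i₂ : Hom B S} (s : IsCoproduct i₁ i₂) where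
    open IsCoproduct s

    copair-ext : ∀ {X} {f g : Hom S X} → f ∘ i₁ ≈ g ∘ i₁ → f ∘ i₂ ≈ g ∘ i₂ → f ≈ g
    copair-ext e e′ = ≈.trans (≈.sym (unique e e′)) (unique ≈.refl ≈.refl)

    -- Arrows out of `S′` are copaired on `S` after going back along `inv`; for uniqueness, `l ∘ k`
    -- is compared with the copairing on `S`.
    coproduct-transport : ∀ {S′} {i₁′ : Hom A S′} {i₂′ : Hom B S′} {k : Hom S S′} →
                          IsIso k → k ∘ i₁ ≈ i₁′ → k ∘ i₂ ≈ i₂′ → IsCoproduct i₁′ i₂′
    coproduct-transport {i₁′ = i₁′} {i₂′} {k} iso e₁ e₂ = record
      { [_,_] = λ f g → [ f , g ] ∘ inv
      ; inject₁ = ≈.trans assoc (≈.trans (∘-cong ≈.refl inv-i₁) inject₁)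
      ; inject₂ = ≈.trans assoc (≈.trans (∘-cong ≈.refl inv-i₂) inject₂)
      ; unique = λ {_} {f} {g} {l} u₁ u₂ → ≈.trans
          (∘-cong (unique {k = l ∘ k} (≈.trans assoc (≈.trans (∘-cong ≈.refl e₁) u₁))
                                      (≈.trans assoc (≈.trans (∘-cong ≈.refl e₂) u₂))) ≈.refl)
          (cancelʳ invʳ) }
      where
        open IsIso iso
        inv-i₁ : inv ∘ i₁′ ≈ i₁
        inv-i₁ = ≈.trans (∘-cong ≈.refl (≈.sym e₁)) (cancelˡ invˡ)
        inv-i₂ : inv ∘ i₂′ ≈ i₂
        inv-i₂ = ≈.trans (∘-cong ≈.refl (≈.sym e₂)) (cancelˡ invˡ)

  module _ {A B P} {π₁ : Hom P A} {π₂ : Hom P B} (p : IsProduct π₁ π₂) where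
    private module P = IsProduct p
    open P hiding (⟨_,_⟩)

    pair-ext : ∀ {X} {f g : Hom X P} → π₁ ∘ f ≈ π₁ ∘ g → π₂ ∘ f ≈ π₂ ∘ g → f ≈ g
    pair-ext e e′ = ≈.trans (≈.sym (unique e e′)) (unique ≈.refl ≈.refl)

    pair-cong : ∀ {X} {f f′ : Hom X A} {g g′ : Hom X B} →
                f ≈ f′ → g ≈ g′ → P.⟨ f , g ⟩ ≈ P.⟨ f′ , g′ ⟩
    pair-cong e e′ = unique (≈.trans project₁ (≈.sym e)) (≈.trans project₂ (≈.sym e′))

    product-transport : ∀ {P′} {π₁′ : Hom P′ A} {π₂′ : Hom P′ B} {k : Hom P′ P} →
                        IsIso k → π₁ ∘ k ≈ π₁′ → π₂ ∘ k ≈ π₂′ → IsProduct π₁′ π₂′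
    product-transport {π₁′ = π₁′} {π₂′} {k} iso e₁ e₂ = record
      { ⟨_,_⟩ = λ f g → inv ∘ P.⟨ f , g ⟩
      ; project₁ = ≈.trans (≈.sym assoc) (≈.trans (∘-cong π₁-inv ≈.refl) project₁)
      ; project₂ = ≈.trans (≈.sym assoc) (≈.trans (∘-cong π₂-inv ≈.refl) project₂)
      ; unique = λ {_} {f} {g} {l} u₁ u₂ → ≈.trans
          (∘-cong ≈.refl (unique {k = k ∘ l}
            (≈.trans (≈.sym assoc) (≈.trans (∘-cong e₁ ≈.refl) u₁))
            (≈.trans (≈.sym assoc) (≈.trans (∘-cong e₂ ≈.refl) u₂))))
          (cancelˡ invˡ) }
      where
        open IsIso iso
        π₁-inv : π₁′ ∘ inv ≈ π₁
        π₁-inv = ≈.trans (∘-cong (≈.sym e₁) ≈.refl) (cancelʳ invʳ)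
        π₂-inv : π₂′ ∘ inv ≈ π₂
        π₂-inv = ≈.trans (∘-cong (≈.sym e₂) ≈.refl) (cancelʳ invʳ)

  initial-transport : ∀ {Z Z′} {k : Hom Z Z′} → IsIso k → IsInitial Z → IsInitial Z′
  initial-transport iso z = record
    { ¡ = ¡ ∘ inv
    ; ¡-unique = λ f → ≈.trans (∘-cong (¡-unique _) ≈.refl) (cancelʳ invʳ) }
    where
      open IsInitial z
      open IsIso iso

  terminal-transport : ∀ {Z Z′} {k : Hom Z′ Z} → IsIso k → IsTerminal Z → IsTerminal Z′
  terminal-transport iso z = record
    { ! = inv ∘ !
    ; !-unique = λ f → ≈.trans (∘-cong ≈.refl (!-unique _)) (cancelˡ invˡ) }
    where
      open IsTerminal z
      open IsIso iso

  initials-isIso : ∀ {Z Z′} (z : IsInitial Z) → IsInitial Z′ → IsIso (IsInitial.¡ z {Z′})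
  initials-isIso z z′ = record
    { inv = z′.¡
    ; invˡ = ≈.trans (≈.sym (z.¡-unique _)) (z.¡-unique id)
    ; invʳ = ≈.trans (≈.sym (z′.¡-unique _)) (z′.¡-unique id) }
    where
      module z = IsInitial z
      module z′ = IsInitial z′

  terminals-isIso : ∀ {Z Z′} (z : IsTerminal Z) → IsTerminal Z′ → IsIso (IsTerminal.! z {Z′})
  terminals-isIso z z′ = record
    { inv = z′.!
    ; invˡ = ≈.trans (≈.sym (z′.!-unique _)) (z′.!-unique id)
    ; invʳ = ≈.trans (≈.sym (z.!-unique _)) (z.!-unique id) }
    where
      module z = IsTerminal z
      module z′ = IsTerminal z′

  coproducts-isIso : ∀ {A B S S′} {i₁ : Hom A S} {i₂ : Hom B S} {i₁′ : Hom A S′} {i₂′ : Hom B S′}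
                     (s : IsCoproduct i₁ i₂) → IsCoproduct i₁′ i₂′ →
                     IsIso (IsCoproduct.[_,_] s i₁′ i₂′)
  coproducts-isIso {i₁ = i₁} {i₂} s s′ = record
    { inv = s′.[ i₁ , i₂ ]
    ; invˡ = copair-ext s
        (≈.trans (round s.inject₁ s′.inject₁) (≈.sym idˡ))
        (≈.trans (round s.inject₂ s′.inject₂) (≈.sym idˡ))
    ; invʳ = copair-ext s′
        (≈.trans (round s′.inject₁ s.inject₁) (≈.sym idˡ))
        (≈.trans (round s′.inject₂ s.inject₂) (≈.sym idˡ)) }
    where
      module s = IsCoproduct s
      module s′ = IsCoproduct s′
      round : ∀ {X Y Z} {i : Hom X Y} {i′ : Hom X Z} {f : Hom Y Z} {g : Hom Z Y} →
              f ∘ i ≈ i′ → g ∘ i′ ≈ i → (g ∘ f) ∘ i ≈ i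
      round e e′ = ≈.trans assoc (≈.trans (∘-cong ≈.refl e) e′)

  products-isIso : ∀ {A B P P′} {π₁ : Hom P A} {π₂ : Hom P B} {π₁′ : Hom P′ A} {π₂′ : Hom P′ B}
                   (p : IsProduct π₁ π₂) → IsProduct π₁′ π₂′ →
                   IsIso (IsProduct.⟨_,_⟩ p π₁′ π₂′)
  products-isIso {π₁ = π₁} {π₂} p p′ = record
    { inv = p′.⟨ π₁ , π₂ ⟩
    ; invˡ = pair-ext p′
        (≈.trans (round p′.project₁ p.project₁) (≈.sym idʳ))
        (≈.trans (round p′.project₂ p.project₂) (≈.sym idʳ))
    ; invʳ = pair-ext p
        (≈.trans (round p.project₁ p′.project₁) (≈.sym idʳ))
        (≈.trans (round p.project₂ p′.project₂) (≈.sym idʳ)) }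
    where
      module p = IsProduct p
      module p′ = IsProduct p′
      round : ∀ {X Y Z} {π : Hom Y X} {π′ : Hom Z X} {f : Hom Z Y} {g : Hom Y Z} →
              π ∘ f ≈ π′ → π′ ∘ g ≈ π → π ∘ (f ∘ g) ≈ π
      round e e′ = ≈.trans (≈.sym assoc) (≈.trans (∘-cong e ≈.refl) e′)

-- Functors preserve isomorphisms; pointwise invertible transformations.

module _ {o h o′ h′} {C : Category o h} {D : Category o′ h′} where
  private
    module C = Category C
    module D = Category D

  F-isIso : (F : Functor C D) → ∀ {A B} {f : C.Hom A B} → C.IsIso f → D.IsIso (Functor.F₁ F f)
  F-isIso F i = record
    { inv = F₁ inv
    ; invˡ = D.≈.trans (D.≈.sym homomorphism) (D.≈.trans (F-resp-≈ invˡ) identity)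
    ; invʳ = D.≈.trans (D.≈.sym homomorphism) (D.≈.trans (F-resp-≈ invʳ) identity) }
    where
      open Functor F
      open C.IsIso i

  inverseNT : {F G : Functor C D} (α : NaturalTransformation F G) →
              (let open NaturalTransformation α) →
              (∀ A → D.IsIso (η A)) → NaturalTransformation G F
  inverseNT α iso = record
    { η = λ A → D.IsIso.inv (iso A)
    ; commute = λ {A} {B} f →
        D.≈.sym (invert-square D (iso A) (iso B) (NaturalTransformation.commute α f)) }

  pointwise-iso : {F G : Functor C D} (α : NaturalTransformation F G) →
                  (let open NaturalTransformation α) →
                  (∀ A → D.IsIso (η A)) → Category.Iso (Functors C D) F G
  pointwise-iso α iso = record
    { to = α
    ; isIso = record
        { inv = inverseNT α iso
        ; invˡ = lift λ A → D.IsIso.invˡ (iso A)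
        ; invʳ = lift λ A → D.IsIso.invʳ (iso A) } }

-- Fully faithful, essentially surjective functors are equivalences.

module _ {o h o′ h′} {C : Category o h} {D : Category o′ h′}
         (F : Functor C D) where
  private
    module C = Category C
    module D = Category D
    open Functor F

  module _
    (full : ∀ {A B} (g : D.Hom (F₀ A) (F₀ B)) → Σ (C.Hom A B) λ f → F₁ f D.≈ g)
    (faithful : ∀ {A B} {f g : C.Hom A B} → F₁ f D.≈ F₁ g → f C.≈ g)
    (surjective : ∀ Y → Σ C.Ob λ X → D.Iso (F₀ X) Y) where

    private
      pre : D.Ob → C.Ob
      pre Y = proj₁ (surjective Y)

      module ε Y = D.Iso (proj₂ (surjective Y))
      module ε⁻¹ Y = D.IsIso (ε.isIso Y)

      F⁻¹₁ : ∀ {X Y} → D.Hom X Y → C.Hom (pre X) (pre Y)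
      F⁻¹₁ {X} {Y} g = proj₁ (full (ε⁻¹.inv Y D.∘ (g D.∘ ε.to X)))

      F-F⁻¹₁ : ∀ {X Y} (g : D.Hom X Y) → F₁ (F⁻¹₁ g) D.≈ ε⁻¹.inv Y D.∘ (g D.∘ ε.to X)
      F-F⁻¹₁ {X} {Y} g = proj₂ (full (ε⁻¹.inv Y D.∘ (g D.∘ ε.to X)))

      -- `F⁻¹₁ g` is a preimage of `g` conjugated by `ε`, so composing with `ε` cancels the inverse.
      -- The functor laws of `F⁻¹` use this square instead of the chosen preimage.
      ε-natural : ∀ {X Y} (g : D.Hom X Y) → ε.to Y D.∘ F₁ (F⁻¹₁ g) D.≈ g D.∘ ε.to X
      ε-natural {X} {Y} g = D.≈.trans (D.∘-cong D.≈.refl (F-F⁻¹₁ g)) (cancelˡ D (ε⁻¹.invʳ Y))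

      -- ε is monic and F faithful, so an arrow into pre Y is determined by ε ∘ F f.
      reflect : ∀ {X Y} {f g : C.Hom X (pre Y)} →
                ε.to Y D.∘ F₁ f D.≈ ε.to Y D.∘ F₁ g → f C.≈ g
      reflect {Y = Y} e = faithful (D.≈.trans (D.≈.sym (cancelˡ D (ε⁻¹.invˡ Y)))
        (D.≈.trans (D.∘-cong D.≈.refl e) (cancelˡ D (ε⁻¹.invˡ Y))))

      F⁻¹ : Functor D C
      F⁻¹ = record
        { F₀ = pre
        ; F₁ = F⁻¹₁
        ; identity = reflect (D.≈.trans (ε-natural _)
            (D.≈.trans D.id-comm (D.∘-cong D.≈.refl (D.≈.sym identity))))
        ; homomorphism = λ {X} {Y} {Z} {f} {g} → reflect (begin
            ε.to Z D.∘ F₁ (F⁻¹₁ (g D.∘ f))              ≈⟨ ε-natural _ ⟩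
            (g D.∘ f) D.∘ ε.to X                        ≈⟨ D.assoc ⟩
            g D.∘ (f D.∘ ε.to X)                        ≈⟨ D.∘-cong D.≈.refl (ε-natural f) ⟨
            g D.∘ (ε.to Y D.∘ F₁ (F⁻¹₁ f))              ≈⟨ D.assoc ⟨
            (g D.∘ ε.to Y) D.∘ F₁ (F⁻¹₁ f)              ≈⟨ D.∘-cong (ε-natural g) D.≈.refl ⟨
            (ε.to Z D.∘ F₁ (F⁻¹₁ g)) D.∘ F₁ (F⁻¹₁ f)    ≈⟨ D.assoc ⟩
            ε.to Z D.∘ (F₁ (F⁻¹₁ g) D.∘ F₁ (F⁻¹₁ f))    ≈⟨ D.∘-cong D.≈.refl homomorphism ⟨
            ε.to Z D.∘ F₁ (F⁻¹₁ g C.∘ F⁻¹₁ f)           ∎)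
        -- The preimages picked by `full` are not assumed to respect `≈`; faithfulness, through
        -- `reflect`, restores this.
        ; F-resp-≈ = λ e → reflect (D.≈.trans (ε-natural _)
            (D.≈.trans (D.∘-cong e D.≈.refl) (D.≈.sym (ε-natural _)))) }
        where open D.HomReasoning

      -- Fullness lifts `ε` at `F₀ X` and its inverse to `C`; faithfulness then makes the two lifts
      -- mutually inverse.
      η : ∀ X → C.Hom X (pre (F₀ X))
      η X = proj₁ (full (ε⁻¹.inv (F₀ X)))

      F-η : ∀ X → F₁ (η X) D.≈ ε⁻¹.inv (F₀ X)
      F-η X = proj₂ (full (ε⁻¹.inv (F₀ X)))

      η⁻¹ : ∀ X → C.Hom (pre (F₀ X)) X
      η⁻¹ X = proj₁ (full (ε.to (F₀ X)))

      F-η⁻¹ : ∀ X → F₁ (η⁻¹ X) D.≈ ε.to (F₀ X)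
      F-η⁻¹ X = proj₂ (full (ε.to (F₀ X)))

      ε-η : ∀ X → ε.to (F₀ X) D.∘ F₁ (η X) D.≈ D.id
      ε-η X = D.≈.trans (D.∘-cong D.≈.refl (F-η X)) (ε⁻¹.invʳ (F₀ X))

    fullyFaithful∧surjective⇒equivalence : IsEquivalenceOfCategories F
    fullyFaithful∧surjective⇒equivalence = record
      { F⁻¹ = F⁻¹
      ; unit = pointwise-iso
          (record
            { η = η
            ; commute = λ {X} {Y} f → reflect (begin
                ε.to (F₀ Y) D.∘ F₁ (η Y C.∘ f)                ≈⟨ D.∘-cong D.≈.refl homomorphism ⟩
                ε.to (F₀ Y) D.∘ (F₁ (η Y) D.∘ F₁ f)           ≈⟨ cancelˡ D (ε-η Y) ⟩
                F₁ f                                          ≈⟨ cancelʳ D (ε-η X) ⟨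
                (F₁ f D.∘ ε.to (F₀ X)) D.∘ F₁ (η X)           ≈⟨ D.∘-cong (ε-natural (F₁ f)) D.≈.refl ⟨
                (ε.to (F₀ Y) D.∘ F₁ (F⁻¹₁ (F₁ f))) D.∘ F₁ (η X)  ≈⟨ D.assoc ⟩
                ε.to (F₀ Y) D.∘ (F₁ (F⁻¹₁ (F₁ f)) D.∘ F₁ (η X))  ≈⟨ D.∘-cong D.≈.refl homomorphism ⟨
                ε.to (F₀ Y) D.∘ F₁ (F⁻¹₁ (F₁ f) C.∘ η X)      ∎) })
          (λ X → record
            { inv = η⁻¹ X
            ; invˡ = faithful (D.≈.trans homomorphism (D.≈.trans
                (D.∘-cong (F-η⁻¹ X) D.≈.refl) (D.≈.trans (ε-η X) (D.≈.sym identity))))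
            ; invʳ = faithful (D.≈.trans homomorphism (D.≈.trans
                (D.∘-cong (F-η X) (F-η⁻¹ X))
                (D.≈.trans (ε⁻¹.invˡ (F₀ X)) (D.≈.sym identity)))) })
      ; counit = pointwise-iso
          (record { η = ε.to ; commute = ε-natural })
          ε.isIso }
      where open D.HomReasoning

-- Preservation of all sums and products from the chosen ones.

module _ {ℓ} (𝔇 : DistributiveCategory ℓ) {o h} {D : Category o h}
         (F : Functor (DistributiveCategory.cat 𝔇) D) where
  private
    module 𝔇 = DistributiveCategory 𝔇
    module D = Category D
    open Functor F

  -- A sum diagram is the chosen one on the same summands followed by a comparison isomorphism.
  -- Functors preserve isomorphisms, so its image is the image of the chosen diagram transported
  -- along an isomorphism; the other three cases are analogous.
  preservesChosen⇒preserves :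
    D.IsInitial (F₀ 𝔇.𝟘) → D.IsTerminal (F₀ 𝔇.𝟙) →
    (∀ {A B} → D.IsCoproduct (F₁ (𝔇.i₁ {A} {B})) (F₁ 𝔇.i₂)) →
    (∀ {A B} → D.IsProduct (F₁ (𝔇.π₁ {A} {B})) (F₁ 𝔇.π₂)) →
    PreservesSumsAndProducts F
  preservesChosen⇒preserves z w s p = record
    { F-initial = λ z′ → initial-transport D (F-isIso F (initials-isIso 𝔇.cat 𝔇.initial z′)) z
    ; F-terminal = λ w′ → terminal-transport D (F-isIso F (terminals-isIso 𝔇.cat 𝔇.terminal w′)) w
    ; F-coproduct = λ s′ → coproduct-transport D s
        (F-isIso F (coproducts-isIso 𝔇.cat 𝔇.coproduct s′))
        (F-triangle (𝔇.IsCoproduct.inject₁ 𝔇.coproduct))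
        (F-triangle (𝔇.IsCoproduct.inject₂ 𝔇.coproduct))
    ; F-product = λ p′ → product-transport D p
        (F-isIso F (products-isIso 𝔇.cat 𝔇.product p′))
        (F-triangle (𝔇.IsProduct.project₁ 𝔇.product))
        (F-triangle (𝔇.IsProduct.project₂ 𝔇.product)) }
    where
      F-triangle : ∀ {X Y Z} {f : 𝔇.Hom X Y} {g : 𝔇.Hom Y Z} {k : 𝔇.Hom X Z} →
                   g 𝔇.∘ f 𝔇.≈ k → F₁ g D.∘ F₁ f D.≈ F₁ k
      F-triangle e = D.≈.trans (D.≈.sym homomorphism) (F-resp-≈ e)

-- Isomorphisms of trees, arcs and internal functors.

module _ {o h} (C : Category o h) where
  open Category C

  -- Induced arrows are functorial in the leaf arrows, so the inverses at the leaves induce the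
  -- inverse at the roots.
  ⟦⟧-isIso : ∀ {t Xs Xs′ X X′} (a : Tree C t Xs X) (a′ : Tree C t Xs′ X′)
             {f : ∀ i → Hom (Xs i) (Xs′ i)} → (∀ i → IsIso (f i)) → IsIso (⟦_,_⟧ C a a′ f)
  ⟦⟧-isIso a a′ iso = record
    { inv = ⟦_,_⟧ C a′ a (λ i → IsIso.inv (iso i))
    ; invˡ = ≈.trans (≈.sym (⟦⟧-∘ C a a′ a))
        (≈.trans (⟦⟧-cong C a a (λ i → IsIso.invˡ (iso i))) (⟦⟧-id C a))
    ; invʳ = ≈.trans (≈.sym (⟦⟧-∘ C a′ a a′))
        (≈.trans (⟦⟧-cong C a′ a′ (λ i → IsIso.invʳ (iso i))) (⟦⟧-id C a′)) }

module _ {ℓ} {C : Category ℓ ℓ} {t u : T} where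
  open Category C

  arcHom-isIso : ∀ {a a′} (k : ArcHom C t u a a′) →
                 (∀ i → IsIso (fs k i)) → (∀ j → IsIso (gs k j)) →
                 Category.IsIso (Arcs C t u) k
  arcHom-isIso {a} {a′} k isoᶠ isoᵍ = record
    { inv = record
        { fs = λ i → IsIso.inv (isoᶠ i)
        ; gs = λ j → IsIso.inv (isoᵍ j)
        ; square = ≈.sym (invert-square C
            (⟦⟧-isIso C (Arc.src a) (Arc.src a′) isoᶠ)
            (⟦⟧-isIso C (Arc.tgt a) (Arc.tgt a′) isoᵍ) (square k)) }
    ; invˡ = (λ i → IsIso.invˡ (isoᶠ i)) , (λ j → IsIso.invˡ (isoᵍ j))
    ; invʳ = (λ i → IsIso.invʳ (isoᶠ i)) , (λ j → IsIso.invʳ (isoᵍ j)) }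

module _ {ℓ} {𝔸 𝔹 : InternalCategory ℓ} {M N : InternalFunctor 𝔸 𝔹} where
  private
    module 𝔸 = Functor 𝔸
    module 𝔹 = Functor 𝔹

  -- The compatibility conditions with the arrows of `𝔊` are squares with `hid` on two sides, so
  -- they invert just as naturality squares do.
  internal-pointwise-iso :
    (b : InternalNT M N) →
    (∀ o A → Category.IsIso (𝔹.F₀ o) (NaturalTransformation.η (InternalNT.α b o) A)) →
    Category.Iso (Int 𝔸 𝔹) M N
  internal-pointwise-iso b iso = record
    { to = b
    ; isIso = record
        { inv = record
            { α = λ o → inverseNT (InternalNT.α b o) (iso o)
            ; α-nat = λ {o} {o′} m A → invert-square (𝔹.F₀ o′)
                (iso o′ (Functor.F₀ (𝔸.F₁ m) A)) (F-isIso (𝔹.F₁ m) (iso o A))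
                (Category.≈.sym (𝔹.F₀ o′) (InternalNT.α-nat b m A)) }
        ; invˡ = λ o A → Category.IsIso.invˡ (iso o A)
        ; invʳ = λ o A → Category.IsIso.invʳ (iso o A) } }

-- Closure properties of the arrows at which a family is natural.

module _ {o h o′ h′} {C : Category o h} {D : Category o′ h′} (F G : Functor C D)
         (η : ∀ A → Category.Hom D (Functor.F₀ F A) (Functor.F₀ G A)) where
  private
    module C = Category C
    module F = Functor F
    module G = Functor G
  open Category D
  open HomReasoning

  -- Naturality is isolated at one arrow, for a family not yet known to be a transformation, so that
  -- it can be proved by induction on how an arrow of `ℱ G` is generated.
  Natural : ∀ {A B} → C.Hom A B → Set h′
  Natural {A} {B} f = η B ∘ F.F₁ f ≈ G.F₁ f ∘ η A

  natural-resp : ∀ {A B} {f g : C.Hom A B} → f C.≈ g → Natural f → Natural g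
  natural-resp e n = ≈.trans (∘-cong ≈.refl (F.F-resp-≈ (C.≈.sym e)))
                    (≈.trans n (∘-cong (G.F-resp-≈ e) ≈.refl))

  natural-id : ∀ {A} → Natural (C.id {A})
  natural-id = ≈.trans (∘-cong ≈.refl F.identity)
              (≈.trans (≈.sym id-comm) (∘-cong (≈.sym G.identity) ≈.refl))

  natural-∘ : ∀ {X Y Z} {g : C.Hom Y Z} {f : C.Hom X Y} → Natural g → Natural f → Natural (g C.∘ f)
  natural-∘ {X} {Y} {Z} {g} {f} n m = begin
    η Z ∘ F.F₁ (g C.∘ f)        ≈⟨ ∘-cong ≈.refl F.homomorphism ⟩
    η Z ∘ (F.F₁ g ∘ F.F₁ f)     ≈⟨ assoc ⟨
    (η Z ∘ F.F₁ g) ∘ F.F₁ f     ≈⟨ ∘-cong n ≈.refl ⟩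
    (G.F₁ g ∘ η Y) ∘ F.F₁ f     ≈⟨ assoc ⟩
    G.F₁ g ∘ (η Y ∘ F.F₁ f)     ≈⟨ ∘-cong ≈.refl m ⟩
    G.F₁ g ∘ (G.F₁ f ∘ η X)     ≈⟨ assoc ⟨
    (G.F₁ g ∘ G.F₁ f) ∘ η X     ≈⟨ ∘-cong G.homomorphism ≈.refl ⟨
    G.F₁ (g C.∘ f) ∘ η X        ∎

  natural-inverse : ∀ {A B} {f : C.Hom A B} (i : C.IsIso f) → Natural f → Natural (C.IsIso.inv i)
  natural-inverse i n = invert-square D (F-isIso F i) (F-isIso G i) (≈.sym n)

  private
    natural-precomposed : ∀ {X Y Z} {k : C.Hom Y Z} {i : C.Hom X Y} →
                          Natural i → Natural (k C.∘ i) →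
                          (η Z ∘ F.F₁ k) ∘ F.F₁ i ≈ (G.F₁ k ∘ η Y) ∘ F.F₁ i
    natural-precomposed {X} {Y} {Z} {k} {i} n m = begin
      (η Z ∘ F.F₁ k) ∘ F.F₁ i   ≈⟨ assoc ⟩
      η Z ∘ (F.F₁ k ∘ F.F₁ i)   ≈⟨ ∘-cong ≈.refl F.homomorphism ⟨
      η Z ∘ F.F₁ (k C.∘ i)      ≈⟨ m ⟩
      G.F₁ (k C.∘ i) ∘ η X      ≈⟨ ∘-cong G.homomorphism ≈.refl ⟩
      (G.F₁ k ∘ G.F₁ i) ∘ η X   ≈⟨ assoc ⟩
      G.F₁ k ∘ (G.F₁ i ∘ η X)   ≈⟨ ∘-cong ≈.refl n ⟨
      G.F₁ k ∘ (η Y ∘ F.F₁ i)   ≈⟨ assoc ⟨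
      (G.F₁ k ∘ η Y) ∘ F.F₁ i   ∎

    natural-postcomposed : ∀ {X Y Z} {k : C.Hom X Y} {π : C.Hom Y Z} →
                           Natural π → Natural (π C.∘ k) →
                           G.F₁ π ∘ (η Y ∘ F.F₁ k) ≈ G.F₁ π ∘ (G.F₁ k ∘ η X)
    natural-postcomposed {X} {Y} {Z} {k} {π} n m = begin
      G.F₁ π ∘ (η Y ∘ F.F₁ k)   ≈⟨ assoc ⟨
      (G.F₁ π ∘ η Y) ∘ F.F₁ k   ≈⟨ ∘-cong n ≈.refl ⟨
      (η Z ∘ F.F₁ π) ∘ F.F₁ k   ≈⟨ assoc ⟩
      η Z ∘ (F.F₁ π ∘ F.F₁ k)   ≈⟨ ∘-cong ≈.refl F.homomorphism ⟨
      η Z ∘ F.F₁ (π C.∘ k)      ≈⟨ m ⟩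
      G.F₁ (π C.∘ k) ∘ η X      ≈⟨ ∘-cong G.homomorphism ≈.refl ⟩
      (G.F₁ π ∘ G.F₁ k) ∘ η X   ≈⟨ assoc ⟩
      G.F₁ π ∘ (G.F₁ k ∘ η X)   ∎

  -- The two sides are arrows out of the `F`-image of a sum, hence may be compared on the images of
  -- the injections, where naturality at `f` and `g` applies.
  natural-copair : ∀ {A B S X} {i₁ : C.Hom A S} {i₂ : C.Hom B S} {f : C.Hom A X} {g : C.Hom B X}
                   (s : C.IsCoproduct i₁ i₂) → IsCoproduct (F.F₁ i₁) (F.F₁ i₂) →
                   Natural i₁ → Natural i₂ → Natural f → Natural g →
                   Natural (C.IsCoproduct.[_,_] s f g)
  natural-copair s s′ n₁ n₂ nf ng = copair-ext D s′
    (natural-precomposed n₁ (natural-resp (C.≈.sym (C.IsCoproduct.inject₁ s)) nf))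
    (natural-precomposed n₂ (natural-resp (C.≈.sym (C.IsCoproduct.inject₂ s)) ng))

  -- Dually, the two sides are arrows into the `G`-image of a product, which is why preservation is
  -- asked of `G` here and of `F` for copairing.
  natural-pair : ∀ {A B P X} {π₁ : C.Hom P A} {π₂ : C.Hom P B} {f : C.Hom X A} {g : C.Hom X B}
                 (p : C.IsProduct π₁ π₂) → IsProduct (G.F₁ π₁) (G.F₁ π₂) →
                 Natural π₁ → Natural π₂ → Natural f → Natural g →
                 Natural (C.IsProduct.⟨_,_⟩ p f g)
  natural-pair p p′ n₁ n₂ nf ng = pair-ext D p′
    (natural-postcomposed n₁ (natural-resp (C.≈.sym (C.IsProduct.project₁ p)) nf))
    (natural-postcomposed n₂ (natural-resp (C.≈.sym (C.IsProduct.project₂ p)) ng))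

-- Restriction along the unit is faithful and full.

module _ {ℓ} (G : DistributiveGraph ℓ) (𝔇 : DistributiveCategory ℓ) where
  private
    module G = Functor G
    module ℱG = DistributiveCategory (ℱ G)
    module 𝔇 = DistributiveCategory 𝔇
  open NaturalTransformation using (η; commute)
  open 𝔇 using (_≈_; _∘_; module ≈; ∘-cong; hid; IsIso)

  restrict : Functor (Dist (ℱ G) 𝔇) (Int (discrete G) (𝒰 𝔇))
  restrict = precompose (unit G) ∘F 𝒰₁ (ℱ G) 𝔇

  imageTree : (P : DistributiveFunctor (ℱ G) 𝔇) → ∀ t (A : Fin (φ t) → G.F₀ ✶) →
              Tree 𝔇.cat t (λ i → Functor.F₀ (proj₁ P) (var (A i))) (Functor.F₀ (proj₁ P) (t [ A ]))
  imageTree (P , pres) t A = mapTree P pres (chosenTree G t A)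

  module _ {P Q : DistributiveFunctor (ℱ G) 𝔇} where
    private
      module P where
        open Functor (proj₁ P) public
        open PreservesSumsAndProducts (proj₂ P) public
      module Q where
        open Functor (proj₁ Q) public
        open PreservesSumsAndProducts (proj₂ Q) public

    -- Induction on expressions. Naturality at the injections fixes a component at a sum because `P`
    -- preserves the sum; naturality at the projections fixes one at a product because `Q` preserves
    -- the product.
    determinedByGenerators :
      (α β : NaturalTransformation (proj₁ P) (proj₁ Q)) →
      (∀ A → η α (var A) ≈ η β (var A)) → ∀ X → η α X ≈ η β X
    determinedByGenerators α β e = go
      where
        go : ∀ X → η α X ≈ η β X
        go (var A) = e A
        go 𝟘 = ≈.trans (≈.sym (¡-unique _)) (¡-unique _)
          where open 𝔇.IsInitial (P.F-initial ℱG.initial)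
        go 𝟙 = ≈.trans (≈.sym (!-unique _)) (!-unique _)
          where open 𝔇.IsTerminal (Q.F-terminal ℱG.terminal)
        go (X ⊕ Y) = copair-ext 𝔇.cat (P.F-coproduct ℱG.coproduct)
          (≈.trans (commute α inj₁) (≈.trans (∘-cong ≈.refl (go X)) (≈.sym (commute β inj₁))))
          (≈.trans (commute α inj₂) (≈.trans (∘-cong ≈.refl (go Y)) (≈.sym (commute β inj₂))))
        go (X ⊗ Y) = pair-ext 𝔇.cat (Q.F-product ℱG.product)
          (≈.trans (≈.sym (commute α prj₁)) (≈.trans (∘-cong (go X) ≈.refl) (commute β prj₁)))
          (≈.trans (≈.sym (commute α prj₂)) (≈.trans (∘-cong (go Y) ≈.refl) (commute β prj₂)))

    module _ (θ : ∀ A → 𝔇.Hom (P.F₀ (var A)) (Q.F₀ (var A))) where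

      -- The clauses mirror those of `⟦_,_⟧` on image trees.
      extend : ∀ X → 𝔇.Hom (P.F₀ X) (Q.F₀ X)
      extend (var A) = θ A
      extend 𝟘 = 𝔇.IsInitial.¡ (P.F-initial ℱG.initial)
      extend 𝟙 = 𝔇.IsTerminal.! (Q.F-terminal ℱG.terminal)
      extend (X ⊕ Y) = 𝔇.IsCoproduct.[_,_] (P.F-coproduct ℱG.coproduct)
        (Q.F₁ inj₁ ∘ extend X) (Q.F₁ inj₂ ∘ extend Y)
      extend (X ⊗ Y) = 𝔇.IsProduct.⟨_,_⟩ (Q.F-product ℱG.product)
        (extend X ∘ P.F₁ prj₁) (extend Y ∘ P.F₁ prj₂)

      -- This turns naturality at an arc into the square of an arc morphism. The two recursions
      -- agree on the nose, so `≡` is available and `natural-arc` can rewrite with it.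
      extend-[] : ∀ t (A : Fin (φ t) → G.F₀ ✶) →
                  extend (t [ A ]) ≡ ⟦_,_⟧ 𝔇.cat (imageTree P t A) (imageTree Q t A) (λ i → θ (A i))
      extend-[] 𝕩 A = refl
      extend-[] 𝟘 A = refl
      extend-[] 𝟙 A = refl
      extend-[] (t ⊕ u) A =
        cong₂ (λ f g → 𝔇.IsCoproduct.[_,_] (P.F-coproduct ℱG.coproduct)
                         (Q.F₁ inj₁ ∘ f) (Q.F₁ inj₂ ∘ g))
          (extend-[] t (left A)) (extend-[] u (right {t = φ t} A))
      extend-[] (t ⊗ u) A =
        cong₂ (λ f g → 𝔇.IsProduct.⟨_,_⟩ (Q.F-product ℱG.product)
                         (f ∘ P.F₁ prj₁) (g ∘ P.F₁ prj₂))
          (extend-[] t (left A)) (extend-[] u (right {t = φ t} A))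

      private
        Nat : ∀ {X Y} → Arrow G X Y → Set ℓ
        Nat = Natural (proj₁ P) (proj₁ Q) extend

      module _ (natural-arc : ∀ {t u} (a : G.F₀ ⟨ t , u ⟩) → Nat (arc {t = t} {u} a)) where
        -- Naturality at injections and projections is the set of equations by which `extend` was
        -- defined at sums and products.
        private
          nat-inj₁ : ∀ {X Y} → Nat (inj₁ {X = X} {Y})
          nat-inj₁ = 𝔇.IsCoproduct.inject₁ (P.F-coproduct ℱG.coproduct)

          nat-inj₂ : ∀ {X Y} → Nat (inj₂ {X = X} {Y})
          nat-inj₂ = 𝔇.IsCoproduct.inject₂ (P.F-coproduct ℱG.coproduct)

          nat-prj₁ : ∀ {X Y} → Nat (prj₁ {X = X} {Y})
          nat-prj₁ = ≈.sym (𝔇.IsProduct.project₁ (Q.F-product ℱG.product))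

          nat-prj₂ : ∀ {X Y} → Nat (prj₂ {X = X} {Y})
          nat-prj₂ = ≈.sym (𝔇.IsProduct.project₂ (Q.F-product ℱG.product))

          nat-copair : ∀ {X Y Z} {f : Arrow G X Z} {g : Arrow G Y Z} →
                       Nat f → Nat g → Nat ⦅ f ∣ g ⦆
          nat-copair = natural-copair (proj₁ P) (proj₁ Q) extend
            ℱG.coproduct (P.F-coproduct ℱG.coproduct) nat-inj₁ nat-inj₂

          nat-pair : ∀ {X Y Z} {f : Arrow G Z X} {g : Arrow G Z Y} →
                     Nat f → Nat g → Nat ⦅ f , g ⦆
          nat-pair = natural-pair (proj₁ P) (proj₁ Q) extend
            ℱG.product (Q.F-product ℱG.product) nat-prj₁ nat-prj₂

          nat-∘ : ∀ {X Y Z} {g : Arrow G Y Z} {f : Arrow G X Y} → Nat g → Nat f → Nat (g ∘ᶠ f)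
          nat-∘ = natural-∘ (proj₁ P) (proj₁ Q) extend

        extend-natural : ∀ {X Y} (f : Arrow G X Y) → Nat f
        extend-natural (arc a) = natural-arc a
        extend-natural idᶠ = natural-id (proj₁ P) (proj₁ Q) extend
        extend-natural (g ∘ᶠ f) = nat-∘ (extend-natural g) (extend-natural f)
        extend-natural inj₁ = nat-inj₁
        extend-natural inj₂ = nat-inj₂
        extend-natural prj₁ = nat-prj₁
        extend-natural prj₂ = nat-prj₂
        extend-natural ¡ᶠ = ≈.trans (≈.sym (¡-unique _)) (¡-unique _)
          where open 𝔇.IsInitial (P.F-initial ℱG.initial)
        extend-natural !ᶠ = ≈.trans (≈.sym (!-unique _)) (!-unique _)
          where open 𝔇.IsTerminal (Q.F-terminal ℱG.terminal)
        -- `δ` is a copairing of pairings built from injections and projections, so naturality there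
        -- is already known, and it passes to the inverse.
        extend-natural δ⁻¹ = natural-inverse (proj₁ P) (proj₁ Q) extend ℱG.distributive
          (nat-copair (nat-pair nat-prj₁ (nat-∘ nat-inj₁ nat-prj₂))
                      (nat-pair nat-prj₁ (nat-∘ nat-inj₂ nat-prj₂)))
        extend-natural ⦅ f ∣ g ⦆ = nat-copair (extend-natural f) (extend-natural g)
        extend-natural ⦅ f , g ⦆ = nat-pair (extend-natural f) (extend-natural g)

    restrict-full : (b : InternalNT (Functor.F₀ restrict P) (Functor.F₀ restrict Q)) →
                    Σ (NaturalTransformation (proj₁ P) (proj₁ Q)) λ β →
                    Category._≈_ (Int (discrete G) (𝒰 𝔇)) (Functor.F₁ restrict {P} {Q} β) b
    restrict-full b = β , agrees
      where
        θ : ∀ A → 𝔇.Hom (P.F₀ (var A)) (Q.F₀ (var A))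
        θ = η (InternalNT.α b ✶)

        onArc : ∀ {t u} (a : G.F₀ ⟨ t , u ⟩) → _
        onArc a = η (InternalNT.α b ⟨ _ , _ ⟩) a

        -- At `d i` and `c j` the strictness equations of both restrictions relate an object to
        -- itself, so their `hid` factors disappear.
        unloop : ∀ {A B} {f g : 𝔇.Hom A B} (p : A ≡ A) (q : B ≡ B) →
                 hid q ∘ f ≈ g ∘ hid p → f ≈ g
        unloop p q e = ≈.trans (≈.sym (≈.trans (∘-cong (hid-loop 𝔇.cat q) ≈.refl) 𝔇.idˡ))
          (≈.trans e (≈.trans (∘-cong ≈.refl (hid-loop 𝔇.cat p)) 𝔇.idʳ))

        θ-fs : ∀ {t u} (a : G.F₀ ⟨ t , u ⟩) i → θ (G.F₁ (d i) a) ≈ fs (onArc {t} {u} a) i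
        θ-fs a i = unloop _ _ (InternalNT.α-nat b (d i) a)

        θ-gs : ∀ {t u} (a : G.F₀ ⟨ t , u ⟩) j → θ (G.F₁ (c j) a) ≈ gs (onArc {t} {u} a) j
        θ-gs a j = unloop _ _ (InternalNT.α-nat b (c j) a)

        -- After the rewriting, the goal is the square of the arc morphism `onArc a`, with its leaf
        -- arrows replaced by the components `θ` that `b` makes equal to them.
        natural-arc : ∀ {t u} (a : G.F₀ ⟨ t , u ⟩) →
                      Natural (proj₁ P) (proj₁ Q) (extend θ) (arc {t = t} {u} a)
        natural-arc {t} {u} a
          rewrite extend-[] θ t (λ i → G.F₁ (d i) a) | extend-[] θ u (λ j → G.F₁ (c j) a) =
          ≈.trans (∘-cong (⟦⟧-cong 𝔇.cat (imageTree P u _) (imageTree Q u _) (θ-gs a)) ≈.refl)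
         (≈.trans (square (onArc a))
                  (∘-cong ≈.refl (≈.sym (⟦⟧-cong 𝔇.cat (imageTree P t _) (imageTree Q t _) (θ-fs a)))))

        β : NaturalTransformation (proj₁ P) (proj₁ Q)
        β = record { η = extend θ ; commute = extend-natural θ natural-arc }

        agrees : Category._≈_ (Int (discrete G) (𝒰 𝔇)) (Functor.F₁ restrict {P} {Q} β) b
        agrees ✶ A = ≈.refl
        agrees ⟨ t , u ⟩ a = θ-fs a , θ-gs a

  -- Essential surjectivity: interpreting the free category.

  module Interpretation (M : InternalFunctor (discrete G) (𝒰 𝔇)) where

    gen₀ : G.F₀ ✶ → 𝔇.Ob
    gen₀ = Functor.F₀ (η M ✶)

    ob : Expr (G.F₀ ✶) → 𝔇.Ob
    ob (var A) = gen₀ A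
    ob 𝟘 = 𝔇.𝟘
    ob 𝟙 = 𝔇.𝟙
    ob (X ⊕ Y) = ob X 𝔇.⊕ ob Y
    ob (X ⊗ Y) = ob X 𝔇.⊗ ob Y

    -- `imageTree` cannot serve here: it takes a distributive functor, and the action of `interpret`
    -- on arcs is itself built from these trees.
    obTree : ∀ t (A : Fin (φ t) → G.F₀ ✶) → Tree 𝔇.cat t (λ i → gen₀ (A i)) (ob (t [ A ]))
    obTree 𝕩 A = gen
    obTree 𝟘 A = init 𝔇.initial
    obTree 𝟙 A = term 𝔇.terminal
    obTree (t ⊕ u) A = sum (obTree t (left A)) (obTree u (right {t = φ t} A)) 𝔇.coproduct
    obTree (t ⊗ u) A = prod (obTree t (left A)) (obTree u (right {t = φ t} A)) 𝔇.product

    module OfArc {t u} (a : G.F₀ ⟨ t , u ⟩) where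
      open Arc (Functor.F₀ (η M ⟨ t , u ⟩) a) public

      doms : Fin (φ t) → G.F₀ ✶
      doms i = G.F₁ (d {t} {u} i) a

      cods : Fin (φ u) → G.F₀ ✶
      cods j = G.F₁ (c {t} {u} j) a

      -- Strict naturality of `M` matches generators with the leaves of its trees only up to `≡`;
      -- `hid` of these equations supplies the leaf arrows.
      dom-eq : ∀ i → gen₀ (doms i) ≡ Xs i
      dom-eq i = _≡F_.eq₀ (commute M (d i)) a

      cod-eq : ∀ j → gen₀ (cods j) ≡ Ys j
      cod-eq j = _≡F_.eq₀ (commute M (c j)) a

      dom-arrow : 𝔇.Hom (ob (t [ doms ])) X
      dom-arrow = ⟦_,_⟧ 𝔇.cat (obTree t doms) src (λ i → hid (dom-eq i))

      cod-isIso : IsIso (⟦_,_⟧ 𝔇.cat (obTree u cods) tgt (λ j → hid (cod-eq j)))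
      cod-isIso = ⟦⟧-isIso 𝔇.cat (obTree u cods) tgt (λ j → hid-isIso 𝔇.cat (cod-eq j))

      -- The solution for the missing side of the square that makes the `hid` arrows at the leaves a
      -- morphism from the interpreted arc to the arc given by `M`.
      image : 𝔇.Hom (ob (t [ doms ])) (ob (u [ cods ]))
      image = IsIso.inv cod-isIso ∘ (arrow ∘ dom-arrow)

    hom : ∀ {X Y} → Arrow G X Y → 𝔇.Hom (ob X) (ob Y)
    hom (arc {t} {u} a) = OfArc.image {t} {u} a
    hom idᶠ = 𝔇.id
    hom (g ∘ᶠ f) = hom g ∘ hom f
    hom inj₁ = 𝔇.i₁
    hom inj₂ = 𝔇.i₂
    hom prj₁ = 𝔇.π₁
    hom prj₂ = 𝔇.π₂
    hom ¡ᶠ = 𝔇.IsInitial.¡ 𝔇.initial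
    hom !ᶠ = 𝔇.IsTerminal.! 𝔇.terminal
    hom δ⁻¹ = IsIso.inv 𝔇.distributive
    hom ⦅ f ∣ g ⦆ = 𝔇.IsCoproduct.[_,_] 𝔇.coproduct (hom f) (hom g)
    hom ⦅ f , g ⦆ = 𝔇.IsProduct.⟨_,_⟩ 𝔇.product (hom f) (hom g)

    hom-cong : ∀ {X Y} {f g : Arrow G X Y} → _≈ᶠ_ G f g → hom f ≈ hom g
    hom-cong reflᶠ = ≈.refl
    hom-cong (symᶠ e) = ≈.sym (hom-cong e)
    hom-cong (transᶠ e e′) = ≈.trans (hom-cong e) (hom-cong e′)
    hom-cong (∘ᶠ-cong e e′) = ∘-cong (hom-cong e) (hom-cong e′)
    hom-cong assocᶠ = 𝔇.assoc
    hom-cong idˡᶠ = 𝔇.idˡ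
    hom-cong idʳᶠ = 𝔇.idʳ
    hom-cong +-β₁ = 𝔇.IsCoproduct.inject₁ 𝔇.coproduct
    hom-cong +-β₂ = 𝔇.IsCoproduct.inject₂ 𝔇.coproduct
    hom-cong (+-uniq e e′) = 𝔇.IsCoproduct.unique 𝔇.coproduct (hom-cong e) (hom-cong e′)
    hom-cong ×-β₁ = 𝔇.IsProduct.project₁ 𝔇.product
    hom-cong ×-β₂ = 𝔇.IsProduct.project₂ 𝔇.product
    hom-cong (×-uniq e e′) = 𝔇.IsProduct.unique 𝔇.product (hom-cong e) (hom-cong e′)
    hom-cong (¡-uniq f) = 𝔇.IsInitial.¡-unique 𝔇.initial (hom f)
    hom-cong (!-uniq f) = 𝔇.IsTerminal.!-unique 𝔇.terminal (hom f)
    hom-cong δ⁻¹-δ = IsIso.invˡ 𝔇.distributive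
    hom-cong δ-δ⁻¹ = IsIso.invʳ 𝔇.distributive

    interpret : DistributiveFunctor (ℱ G) 𝔇
    interpret = functor ,
      -- The chosen diagrams of `ℱ G` go definitionally to the chosen diagrams of `𝔇`.
      preservesChosen⇒preserves (ℱ G) functor 𝔇.initial 𝔇.terminal 𝔇.coproduct 𝔇.product
      where
        functor : Functor ℱG.cat 𝔇.cat
        functor = record
          { F₀ = ob ; F₁ = hom ; identity = ≈.refl ; homomorphism = ≈.refl ; F-resp-≈ = hom-cong }

    -- The two trees carry the same diagrams; only the proofs of universality differ.
    ⟦image⟧≈⟦ob⟧ : ∀ t (A : Fin (φ t) → G.F₀ ✶) {Ys Y} (b : Tree 𝔇.cat t Ys Y)
                  {f : ∀ i → 𝔇.Hom (gen₀ (A i)) (Ys i)} →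
                  ⟦_,_⟧ 𝔇.cat (imageTree interpret t A) b f ≈ ⟦_,_⟧ 𝔇.cat (obTree t A) b f
    ⟦image⟧≈⟦ob⟧ 𝕩 A gen = ≈.refl
    -- Only `𝟘` and `⊕` use the universal property in the source tree, where the proofs differ; `𝟙`
    -- and `⊗` use the one in `b`, common to both sides.
    ⟦image⟧≈⟦ob⟧ 𝟘 A (init z) = ≈.sym (𝔇.IsInitial.¡-unique 𝔇.initial _)
    ⟦image⟧≈⟦ob⟧ 𝟙 A (term z) = ≈.refl
    ⟦image⟧≈⟦ob⟧ (t ⊕ u) A (sum l r s) =
      𝔇.IsCoproduct.unique (PreservesSumsAndProducts.F-coproduct (proj₂ interpret)
        (ℱG.coproduct {t [ left A ]} {u [ right {t = φ t} A ]}))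
        (≈.trans (𝔇.IsCoproduct.inject₁ 𝔇.coproduct)
                 (∘-cong ≈.refl (≈.sym (⟦image⟧≈⟦ob⟧ t (left A) l))))
        (≈.trans (𝔇.IsCoproduct.inject₂ 𝔇.coproduct)
                 (∘-cong ≈.refl (≈.sym (⟦image⟧≈⟦ob⟧ u (right {t = φ t} A) r))))
    ⟦image⟧≈⟦ob⟧ (t ⊗ u) A (prod l r p) =
      pair-cong 𝔇.cat p (∘-cong (⟦image⟧≈⟦ob⟧ t (left A) l) ≈.refl)
                        (∘-cong (⟦image⟧≈⟦ob⟧ u (right {t = φ t} A) r) ≈.refl)

    private
      restricted : InternalFunctor (discrete G) (𝒰 𝔇)
      restricted = Functor.F₀ restrict interpret

    counit : InternalNT restricted M
    counit = record { α = component ; α-nat = compatible }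
      where
        module U = Functor (𝒰 𝔇)

        family : ∀ o (a : G.F₀ o) →
                 Category.Hom (U.F₀ o) (Functor.F₀ (η restricted o) a) (Functor.F₀ (η M o) a)
        family ✶ A = 𝔇.id
        family ⟨ t , u ⟩ a = record
          { fs = λ i → hid (dom-eq i)
          ; gs = λ j → hid (cod-eq j)
          -- Passing to `obTree` exposes the isomorphism whose inverse starts `image`, and the two
          -- cancel.
          ; square = ≈.trans (∘-cong (⟦image⟧≈⟦ob⟧ u cods tgt) ≈.refl)
              (≈.trans (cancelˡ 𝔇.cat (IsIso.invʳ cod-isIso))
                       (∘-cong ≈.refl (≈.sym (⟦image⟧≈⟦ob⟧ t doms src)))) }
          where open OfArc {t} {u} a

        component : ∀ o → NaturalTransformation (η restricted o) (η M o)
        component o = record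
          { η = family o
          ; commute = λ { refl → natural-id (η restricted o) (η M o) (family o) } }

        compatible : ∀ {o o′} (m : 𝔊-Hom o o′) A → let module Uo′ = Category (U.F₀ o′) in
                     Uo′.hid (_≡F_.eq₀ (commute M m) A) Uo′.∘ family o′ (G.F₁ m A)
                     Uo′.≈ Functor.F₁ (U.F₁ m) (family o A)
                           Uo′.∘ Uo′.hid (_≡F_.eq₀ (commute restricted m) A)
        -- `G.F₁ ι A` equals `A` only propositionally, so the family is moved along that equation.
        -- At `d i` and `c j` the leaf arrow is the strictness `hid` of `M` itself, and only a loop
        -- remains.
        compatible {o} ι A = hid-family (U.F₀ o) (family o) (G.identity A)
          (_≡F_.eq₀ (commute restricted ι) A) (_≡F_.eq₀ (commute M ι) A)
        compatible (d i) A = ∘-cong ≈.refl (≈.sym (hid-loop 𝔇.cat _))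
        compatible (c j) A = ∘-cong ≈.refl (≈.sym (hid-loop 𝔇.cat _))

    counit-iso : Category.Iso (Int (discrete G) (𝒰 𝔇)) restricted M
    counit-iso = internal-pointwise-iso counit λ
      { ✶ A → hid-isIso 𝔇.cat {gen₀ A} refl
      ; ⟨ t , u ⟩ a → arcHom-isIso (η (InternalNT.α counit ⟨ t , u ⟩) a)
          (λ i → hid-isIso 𝔇.cat (OfArc.dom-eq {t} {u} a i))
          (λ j → hid-isIso 𝔇.cat (OfArc.cod-eq {t} {u} a j)) }

theorem16 : ∀ {ℓ} (G : DistributiveGraph ℓ) (𝔇 : DistributiveCategory ℓ) →
    IsEquivalenceOfCategories {C = Dist (ℱ G) 𝔇} {D = Int (discrete G) (𝒰 𝔇)}
    (precompose (unit G) ∘F 𝒰₁ (ℱ G) 𝔇)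
theorem16 G 𝔇 = fullyFaithful∧surjective⇒equivalence (restrict G 𝔇)
  (restrict-full G 𝔇)
  -- Agreement at `✶` is agreement at the generators, which suffices for faithfulness.
  (λ {P} {Q} {α} {β} e → determinedByGenerators G 𝔇 {P} {Q} α β (e ✶))
  (λ M → let open Interpretation G 𝔇 M in interpret , counit-iso)
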